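{- Let $\{p_n(x)\}_{n\ge0}$ and $\{q_n(x)\}_{n\ge0}$ be sequences of polynomials with $\deg p_n(x)=\deg q_n(x)=n$, and let $\sigma_{n,k}$ and $\nu_{n,k}$ be the mixed moments and coefficients of $\{p_n(x)\}_{n\ge0}$ relative to $\{q_n(x)\}_{n\ge0}$, i.e. \[ q_n(x)=\sum_{k=0}^n\sigma_{n,k}\,p_k(x),\qquad p_n(x)=\sum_{k=0}^n\nu_{n,k}\,q_k(x). \] If $w$ is a weight system on the lecture hall graph such that \[ \sigma_{n,k}=h^w_{n,k}\quad\text{for all } n\ge k\ge0, \] then \[ \nu_{n,k}=(-1)^{n-k}e^w_{n,k}\quad\text{for all } n\ge k\ge 0. \] Conversely, if $w$ is a weight system such that $\nu_{n,k}=(-1)^{n-k}e^w_{n,k}$ for all $n\ge k\ge0$, then $\sigma_{n,k}=h^w_{n,k}$ for all $n\ge k\ge0$.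
   Context: Lecture hall graph. For integers $t\ge0$, $0\le j\le i$ put $v^t_{i,j}=(i,\,t+\frac{j}{i+1})$, and set $v^t_{i,i+1}:=v^{t+1}_{i,0}$. The vertices of the lecture hall graph are all $v^t_{i,j}$; its edges join $v^t_{i,j}$ with $v^t_{i,j+1}$ (vertical edges) and $v^t_{i,j}$ with $v^t_{i+1,j}$, for $t\ge 0$, $0\le j\le i$. An east step is a directed edge $(v^t_{i,j},v^t_{i+1,j})$; a south (resp. north) step is a vertical edge directed downwards, $(v^t_{i,j+1},v^t_{i,j})$ (resp. upwards, $(v^t_{i,j},v^t_{i,j+1})$). A weight system $w$ assigns a weight $w(t;i,j)$ to each east step $(v^t_{i,j},v^t_{i+1,j})$. The weight $w(p)$ of a path is the product of the weights of its east steps. $\mathrm{SE}((k,\infty)\to(n,0))$ is the set of paths $(\dots,v_2,v_1,v_0)$ with $v_0=(n,0)$, $\lim_{m\to\infty}v_m=(k,\infty)$, and each $(v_{m+1},v_m)$ a south or east step. $\mathrm{NE}^*((k,0)\to(n,\infty))$ is the set of paths $(v_0,v_1,v_2,\dots)$ with $v_0=(k,0)$, $\lim_{m\to\infty}v_m=(n,\infty)$, each $(v_m,v_{m+1})$ a north or east step, and with no two consecutive east steps. Define \[ h^w_{n,k}=\sum_{p\in \mathrm{SE}((k,\infty)\to(n,0))}w(p),\qquad e^w_{n,k}=\sum_{p\in \mathrm{NE}^*((k,0)\to(n,\infty))}w(p) \] (so $h^w_{n,n}=e^w_{n,n}=1$ and both vanish if $n<k$). The polynomials have coefficients in a field containing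 the weights. Infinite sums are understood formally: weights are assumed to be such that these sums are well defined, e.g. finitely many nonzero weights $w(t;i,j)$ for each $i$, or weights in a ring of formal power series such that for each $i$ the family $(w(t;i,j))_{t,j}$ is summable (each monomial has nonzero coefficient in only finitely many members). -}

module Defs where

open import Algebra.Apartness.Bundles using (HeytingField)
open import Algebra.Bundles using (CommutativeRing; RawRing)
import Algebra.Definitions.RawSemiring as RawSemiringDefinitions
open import Algebra.Morphism.Structures using (module RingMorphisms)
open import Data.Empty using (⊥-elim)
open import Data.Fin.Base using (Fin; zero; suc; inject₁; fromℕ)
open import Data.List.Base using (List; []; _∷_; _++_; map; concatMap; foldr; upTo; filter; length; replicate; deduplicate)
open import Data.List.Membership.Propositional using (_∈_)
open import Data.List.Membership.Propositional.Properties using (∈-filter⁺; ∈-filter⁻; ∈-deduplicate⁺; ∈-deduplicate⁻)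
open import Data.List.Membership.Propositional.Properties.WithK using (unique∧set⇒bag)
import Data.List.Membership.Setoid as SetoidMembership
open import Data.List.Properties using (length-++; filter-++)
open import Data.List.Relation.Binary.BagAndSetEquality using (∼bag⇒↭)
import Data.List.Relation.Binary.Permutation.Propositional as Perm
open import Data.List.Relation.Binary.Permutation.Propositional using (_↭_)
open import Data.List.Relation.Unary.Any using (here)
import Data.List.Relation.Unary.Unique.DecPropositional.Properties as UniqueDec
import Data.List.Relation.Unary.Unique.Setoid as SetoidUnique
open import Data.Nat.Base as ℕ using (ℕ; zero; suc; _≤_; _<_; _∸_)
import Data.Nat.Properties as ℕₚ
open import Data.Product.Base using (∃; _×_; _,_; proj₁; proj₂)
open import Data.Sum.Base using (_⊎_; [_,_])
open import Function.Base using (_∘_; const)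
open import Function.Bundles using (mk⇔)
open import Level using (_⊔_)
open import Relation.Binary.Bundles using (Setoid)
open import Relation.Binary.Core using (Rel)
open import Relation.Binary.Definitions using (DecidableEquality)
open import Relation.Binary.PropositionalEquality as ≡ using (_≡_; refl)
open import Relation.Nullary using (¬_; yes; no)

big : ∀ {c i} {C : Set c} {I : Set i} → (C → C → C) → C → List I → (I → C) → C
big _∙_ ε is f = foldr (λ i s → f i ∙ s) ε is

------------------------------------------------------------------------
-- The ring of formal power series over A in an arbitrary (possibly empty,
-- possibly infinite) set X of variables.

module PowerSeries {a ℓ x} (A : CommutativeRing a ℓ)
                   {X : Set x} (_≟_ : DecidableEquality X) where

  private module A = CommutativeRing A

  -- A list of variables stands for their product.
  Monomial : Set x
  Monomial = List X

  exponent : X → Monomial → ℕ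
  exponent x μ = length (filter (x ≟_) μ)

  infix 4 _≈ₘ_

  _≈ₘ_ : Rel Monomial x
  μ ≈ₘ μ′ = ∀ x → exponent x μ ≡ exponent x μ′

  shift : X → ℕ → ℕ → Monomial × Monomial → Monomial × Monomial
  shift x d i (α , β) = replicate i x ++ α , replicate (d ∸ i) x ++ β

  -- All (α , β) in the listed variables such that every listed x has total
  -- exponent e x in αβ.
  factorsOver : List X → (X → ℕ) → List (Monomial × Monomial)
  factorsOver []       e = ([] , []) ∷ []
  factorsOver (x ∷ xs) e =
    concatMap (λ i → map (shift x (e x) i) (factorsOver xs e)) (upTo (suc (e x)))

  -- The pairs of monomials with product μ, each exactly once up to _≈ₘ_.
  factorizations : Monomial → List (Monomial × Monomial)
  factorizations μ = factorsOver (deduplicate _≟_ μ) (λ x → exponent x μ)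

  record Series : Set (a ⊔ ℓ ⊔ x) where
    field
      coeff      : Monomial → A.Carrier
      coeff-cong : ∀ {μ μ′} → μ ≈ₘ μ′ → coeff μ A.≈ coeff μ′

  open Series public

  infix 4 _≈ₛ_

  _≈ₛ_ : Rel Series (ℓ ⊔ x)
  f ≈ₛ g = ∀ μ → coeff f μ A.≈ coeff g μ

  convolution : (f g : Series) → Monomial → A.Carrier
  convolution f g μ =
    big A._+_ A.0# (factorizations μ) (λ (α , β) → coeff f α A.* coeff g β)

  -- The coefficients of a product do not depend on the list representing a
  -- monomial.
  open import Relation.Binary.Reasoning.Setoid A.setoid

  ∑ : ∀ {i} {I : Set i} → List I → (I → A.Carrier) → A.Carrier
  ∑ = big A._+_ A.0#

  ∑-cong : ∀ {i} {I : Set i} (is : List I) {f g : I → A.Carrier} →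
           (∀ i → f i A.≈ g i) → ∑ is f A.≈ ∑ is g
  ∑-cong []       eq = A.refl
  ∑-cong (i ∷ is) eq = A.+-cong (eq i) (∑-cong is eq)

  ∑-++ : ∀ {i} {I : Set i} (is js : List I) (f : I → A.Carrier) →
         ∑ (is ++ js) f A.≈ ∑ is f A.+ ∑ js f
  ∑-++ []       js f = A.sym (A.+-identityˡ _)
  ∑-++ (i ∷ is) js f = A.trans (A.+-congˡ (∑-++ is js f)) (A.sym (A.+-assoc _ _ _))

  ∑-map : ∀ {i j} {I : Set i} {J : Set j} (g : I → J) (is : List I) (f : J → A.Carrier) →
          ∑ (map g is) f ≡ ∑ is (f ∘ g)
  ∑-map g []       f = refl
  ∑-map g (i ∷ is) f = ≡.cong (f (g i) A.+_) (∑-map g is f)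

  ∑-concatMap : ∀ {i j} {I : Set i} {J : Set j} (g : I → List J) (is : List I)
                (f : J → A.Carrier) → ∑ (concatMap g is) f A.≈ ∑ is (λ i → ∑ (g i) f)
  ∑-concatMap g []       f = A.refl
  ∑-concatMap g (i ∷ is) f =
    A.trans (∑-++ (g i) (concatMap g is) f) (A.+-congˡ (∑-concatMap g is f))

  ∑-zero : ∀ {i} {I : Set i} (is : List I) → ∑ is (const A.0#) A.≈ A.0#
  ∑-zero []       = A.refl
  ∑-zero (_ ∷ is) = A.trans (A.+-identityˡ _) (∑-zero is)

  ∑-+ : ∀ {i} {I : Set i} (is : List I) (f g : I → A.Carrier) →
        ∑ is (λ i → f i A.+ g i) A.≈ ∑ is f A.+ ∑ is g
  ∑-+ []       f g = A.sym (A.+-identityˡ _)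
  ∑-+ (i ∷ is) f g = begin
    (f i A.+ g i) A.+ ∑ is (λ i → f i A.+ g i) ≈⟨ A.+-congˡ (∑-+ is f g) ⟩
    (f i A.+ g i) A.+ (∑ is f A.+ ∑ is g)      ≈⟨ A.+-assoc _ _ _ ⟩
    f i A.+ (g i A.+ (∑ is f A.+ ∑ is g))      ≈⟨ A.+-congˡ (A.sym (A.+-assoc _ _ _)) ⟩
    f i A.+ ((g i A.+ ∑ is f) A.+ ∑ is g)      ≈⟨ A.+-congˡ (A.+-congʳ (A.+-comm _ _)) ⟩
    f i A.+ ((∑ is f A.+ g i) A.+ ∑ is g)      ≈⟨ A.+-congˡ (A.+-assoc _ _ _) ⟩
    f i A.+ (∑ is f A.+ (g i A.+ ∑ is g))      ≈⟨ A.sym (A.+-assoc _ _ _) ⟩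
    (f i A.+ ∑ is f) A.+ (g i A.+ ∑ is g)      ∎

  ∑-swap : ∀ {i j} {I : Set i} {J : Set j} (is : List I) (js : List J)
           (f : I → J → A.Carrier) →
           ∑ is (λ i → ∑ js (f i)) A.≈ ∑ js (λ j → ∑ is (λ i → f i j))
  ∑-swap []       js f = A.sym (∑-zero js)
  ∑-swap (i ∷ is) js f =
    A.trans (A.+-congˡ (∑-swap is js f)) (A.sym (∑-+ js (f i) (λ j → ∑ is (λ i → f i j))))

  exponent-++ : ∀ x μ μ′ → exponent x (μ ++ μ′) ≡ exponent x μ ℕ.+ exponent x μ′
  exponent-++ x μ μ′ = ≡.trans (≡.cong length (filter-++ (x ≟_) μ μ′)) (length-++ (filter (x ≟_) μ))

  ++-congʳ : ∀ ρ {α α′} → α ≈ₘ α′ → ρ ++ α ≈ₘ ρ ++ α′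
  ++-congʳ ρ {α} {α′} eq x = ≡.trans (exponent-++ x ρ α)
    (≡.trans (≡.cong (exponent x ρ ℕ.+_) (eq x)) (≡.sym (exponent-++ x ρ α′)))

  ++-exchange : ∀ ρ τ α → ρ ++ τ ++ α ≈ₘ τ ++ ρ ++ α
  ++-exchange ρ τ α x
    rewrite exponent-++ x ρ (τ ++ α) | exponent-++ x τ α
          | exponent-++ x τ (ρ ++ α) | exponent-++ x ρ α
    = ≡.trans (≡.sym (ℕₚ.+-assoc r t s))
        (≡.trans (≡.cong (ℕ._+ s) (ℕₚ.+-comm r t)) (ℕₚ.+-assoc t r s))
    where r = exponent x ρ ; t = exponent x τ ; s = exponent x α

  Respects : (Monomial × Monomial → A.Carrier) → Set (ℓ ⊔ x)
  Respects F = ∀ {α α′ β β′} → α ≈ₘ α′ → β ≈ₘ β′ → F (α , β) A.≈ F (α′ , β′)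

  shift-respects : ∀ {F} x d i → Respects F → Respects (F ∘ shift x d i)
  shift-respects x d i resp p q =
    resp (++-congʳ (replicate i x) p) (++-congʳ (replicate (d ∸ i) x) q)

  sum-cons : ∀ F x xs e → ∑ (factorsOver (x ∷ xs) e) F A.≈
             ∑ (upTo (suc (e x))) (λ i → ∑ (factorsOver xs e) (F ∘ shift x (e x) i))
  sum-cons F x xs e = A.trans
    (∑-concatMap (λ i → map (shift x (e x) i) (factorsOver xs e)) (upTo (suc (e x))) F)
    (∑-cong (upTo (suc (e x)))
      (λ i → A.reflexive (∑-map (shift x (e x) i) (factorsOver xs e) F)))

  sum-cons₂ : ∀ F x y xs e → ∑ (factorsOver (x ∷ y ∷ xs) e) F A.≈
              ∑ (upTo (suc (e x))) (λ i → ∑ (upTo (suc (e y))) (λ j →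
                ∑ (factorsOver xs e) (F ∘ shift x (e x) i ∘ shift y (e y) j)))
  sum-cons₂ F x y xs e = A.trans (sum-cons F x (y ∷ xs) e)
    (∑-cong (upTo (suc (e x))) (λ i → sum-cons (F ∘ shift x (e x) i) y xs e))

  sum-↭ : ∀ {F} {xs ys} e → Respects F → xs ↭ ys →
          ∑ (factorsOver xs e) F A.≈ ∑ (factorsOver ys e) F
  sum-↭ e resp Perm.refl = A.refl
  sum-↭ {F} {x ∷ xs} {_ ∷ ys} e resp (Perm.prep _ p) = begin
    ∑ (factorsOver (x ∷ xs) e) F
      ≈⟨ sum-cons F x xs e ⟩
    ∑ (upTo (suc (e x))) (λ i → ∑ (factorsOver xs e) (F ∘ shift x (e x) i))
      ≈⟨ ∑-cong (upTo (suc (e x))) (λ i → sum-↭ e (shift-respects {F} x (e x) i resp) p) ⟩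
    ∑ (upTo (suc (e x))) (λ i → ∑ (factorsOver ys e) (F ∘ shift x (e x) i))
      ≈⟨ A.sym (sum-cons F x ys e) ⟩
    ∑ (factorsOver (x ∷ ys) e) F ∎
  sum-↭ {F} {x ∷ y ∷ xs} {_ ∷ _ ∷ ys} e resp (Perm.swap _ _ p) = begin
    ∑ (factorsOver (x ∷ y ∷ xs) e) F
      ≈⟨ sum-cons₂ F x y xs e ⟩
    ∑ I (λ i → ∑ J (λ j → ∑ (factorsOver xs e) (F ∘ shift x (e x) i ∘ shift y (e y) j)))
      ≈⟨ ∑-swap I J _ ⟩
    ∑ J (λ j → ∑ I (λ i → ∑ (factorsOver xs e) (F ∘ shift x (e x) i ∘ shift y (e y) j)))
      ≈⟨ ∑-cong J (λ j → ∑-cong I (λ i → ∑-cong (factorsOver xs e) (λ (α , β) → resp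
           (++-exchange (replicate i x) (replicate j y) α)
           (++-exchange (replicate (e x ∸ i) x) (replicate (e y ∸ j) y) β)))) ⟩
    ∑ J (λ j → ∑ I (λ i → ∑ (factorsOver xs e) (F ∘ shift y (e y) j ∘ shift x (e x) i)))
      ≈⟨ ∑-cong J (λ j → ∑-cong I (λ i → sum-↭ e
           (shift-respects {F ∘ shift y (e y) j} x (e x) i
             (shift-respects {F} y (e y) j resp)) p)) ⟩
    ∑ J (λ j → ∑ I (λ i → ∑ (factorsOver ys e) (F ∘ shift y (e y) j ∘ shift x (e x) i)))
      ≈⟨ A.sym (sum-cons₂ F y x ys e) ⟩
    ∑ (factorsOver (y ∷ x ∷ ys) e) F ∎
    where I = upTo (suc (e x)) ; J = upTo (suc (e y))
  sum-↭ e resp (Perm.trans p q) = A.trans (sum-↭ e resp p) (sum-↭ e resp q)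

  factorsOver-cong : ∀ xs {e e′} → (∀ x → e x ≡ e′ x) → factorsOver xs e ≡ factorsOver xs e′
  factorsOver-cong []       eq = refl
  factorsOver-cong (x ∷ xs) eq rewrite eq x | factorsOver-cong xs eq = refl

  ∈-resp-≈ₘ : ∀ {x μ μ′} → μ ≈ₘ μ′ → x ∈ μ → x ∈ μ′
  ∈-resp-≈ₘ {x} {μ} {μ′} eq x∈μ
    with filter (x ≟_) μ in p | filter (x ≟_) μ′ in q | eq x | ∈-filter⁺ (x ≟_) x∈μ refl
  ... | _ ∷ _ | y ∷ ys | _ | _
    with ∈-filter⁻ (x ≟_) {xs = μ′} (≡.subst (y ∈_) (≡.sym q) (here refl))
  ...   | y∈μ′ , refl = y∈μ′

  support-↭ : ∀ {μ μ′} → μ ≈ₘ μ′ → deduplicate _≟_ μ ↭ deduplicate _≟_ μ′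
  support-↭ {μ} {μ′} eq = ∼bag⇒↭ (unique∧set⇒bag
    (UniqueDec.deduplicate-! _≟_ μ) (UniqueDec.deduplicate-! _≟_ μ′)
    (mk⇔ (transfer eq) (transfer (λ x → ≡.sym (eq x)))))
    where
    transfer : ∀ {x μ μ′} → μ ≈ₘ μ′ → x ∈ deduplicate _≟_ μ → x ∈ deduplicate _≟_ μ′
    transfer {μ = μ} eq = ∈-deduplicate⁺ _≟_ ∘ ∈-resp-≈ₘ eq ∘ ∈-deduplicate⁻ _≟_ μ

  convolution-cong : ∀ f g {μ μ′} → μ ≈ₘ μ′ → convolution f g μ A.≈ convolution f g μ′
  convolution-cong f g {μ} {μ′} eq = A.trans
    (sum-↭ {F} (λ x → exponent x μ) (λ p q → A.*-cong (coeff-cong f p) (coeff-cong g q))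
      (support-↭ {μ} {μ′} eq))
    (A.reflexive (≡.cong (λ l → ∑ l F) (factorsOver-cong (deduplicate _≟_ μ′) eq)))
    where
    F : Monomial × Monomial → A.Carrier
    F (α , β) = coeff f α A.* coeff g β

  private
    head-occurs : ∀ x μ → ¬ (exponent x (x ∷ μ) ≡ 0)
    head-occurs x μ eq with x ≟ x
    head-occurs x μ () | yes _
    head-occurs x μ eq | no x≢x = x≢x refl

  constant : A.Carrier → Series
  constant c .coeff []      = c
  constant c .coeff (_ ∷ _) = A.0#
  constant c .coeff-cong {[]}    {[]}    eq = A.refl
  constant c .coeff-cong {[]}    {x ∷ μ} eq = ⊥-elim (head-occurs x μ (≡.sym (eq x)))
  constant c .coeff-cong {x ∷ μ} {[]}    eq = ⊥-elim (head-occurs x μ (eq x))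
  constant c .coeff-cong {_ ∷ _} {_ ∷ _} eq = A.refl

  seriesRing : RawRing (a ⊔ ℓ ⊔ x) (ℓ ⊔ x)
  seriesRing = record
    { Carrier = Series
    ; _≈_     = _≈ₛ_
    ; _+_     = λ f g → record
        { coeff      = λ μ → coeff f μ A.+ coeff g μ
        ; coeff-cong = λ eq → A.+-cong (coeff-cong f eq) (coeff-cong g eq) }
    ; _*_     = λ f g → record
        { coeff      = convolution f g
        ; coeff-cong = λ {μ} {μ′} eq → convolution-cong f g {μ} {μ′} eq }
    ; -_      = λ f → record
        { coeff      = λ μ → A.- coeff f μ
        ; coeff-cong = λ eq → A.-‿cong (coeff-cong f eq) }
    ; 0#      = constant A.0#
    ; 1#      = constant A.1#
    }

  -- The next two definitions concern families indexed by a setoid.  When X is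
  -- empty a series is just an element of A, and a family is summable exactly
  -- when only finitely many of its members are nonzero.

  module _ {i ℓᵢ} (I : Setoid i ℓᵢ) where
    open SetoidMembership I using (_∉_)
    open SetoidUnique I using (Unique)

    Summable : (Setoid.Carrier I → Series) → Set _
    Summable f = ∀ μ → ∃ λ is → ∀ i → i ∉ is → coeff (f i) μ A.≈ A.0#

    HasSum : (Setoid.Carrier I → Series) → Series → Set _
    HasSum f s = ∀ μ → ∃ λ is →
      Unique is
      × (∀ i → i ∉ is → coeff (f i) μ A.≈ A.0#)
      × coeff s μ A.≈ big A._+_ A.0# is (λ i → coeff (f i) μ)

------------------------------------------------------------------------
-- The lecture hall graph

-- v t i j is the point (i , t + j/(i+1)).
record Vertex : Set where
  constructor v
  field
    level  : ℕ
    column : ℕ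
    index  : Fin (suc column)

open Vertex public

data North : Vertex → Vertex → Set where
  inner : ∀ {t i} (j : Fin i) → North (v t i (inject₁ j)) (v t i (suc j))
  wrap  : ∀ {t i} → North (v t i (fromℕ i)) (v (suc t) i zero)

South : Vertex → Vertex → Set
South u u′ = North u′ u

data East : Vertex → Vertex → Set where
  east : ∀ {t i} (j : Fin (suc i)) → East (v t i j) (v t (suc i) (inject₁ j))

-- lim u m = (k , ∞): the abscissae are integers, so they are eventually k;
-- the ordinates lie in [level , level + 1), so they tend to ∞ with the levels.
TendsTo∞ : (ℕ → Vertex) → ℕ → Set
TendsTo∞ u k = ∀ B → ∃ λ M → ∀ m → M ≤ m → column (u m) ≡ k × B ≤ level (u m)

-- The path (… , at 2 , at 1 , at 0).
record SEPath (k n : ℕ) : Set where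
  field
    at    : ℕ → Vertex
    start : at 0 ≡ v 0 n zero
    step  : ∀ m → South (at (suc m)) (at m) ⊎ East (at (suc m)) (at m)
    limit : TendsTo∞ at k

record NE*Path (k n : ℕ) : Set where
  field
    at    : ℕ → Vertex
    start : at 0 ≡ v 0 k zero
    step  : ∀ m → North (at m) (at (suc m)) ⊎ East (at m) (at (suc m))
    noEE  : ∀ m → East (at m) (at (suc m)) → ¬ East (at (suc m)) (at (suc (suc m)))
    limit : TendsTo∞ at n

sePaths : ℕ → ℕ → Setoid _ _
sePaths k n = record
  { Carrier       = SEPath k n
  ; _≈_           = λ p p′ → ∀ m → SEPath.at p m ≡ SEPath.at p′ m
  ; isEquivalence = record
      { refl = λ _ → refl ; sym = λ e m → ≡.sym (e m) ; trans = λ e e′ m → ≡.trans (e m) (e′ m) }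
  }

ne*Paths : ℕ → ℕ → Setoid _ _
ne*Paths k n = record
  { Carrier       = NE*Path k n
  ; _≈_           = λ p p′ → ∀ m → NE*Path.at p m ≡ NE*Path.at p′ m
  ; isEquivalence = record
      { refl = λ _ → refl ; sym = λ e m → ≡.sym (e m) ; trans = λ e e′ m → ≡.trans (e m) (e′ m) }
  }

module LectureHall {a ℓ x} (A : CommutativeRing a ℓ)
                   {X : Set x} (_≟_ : DecidableEquality X) where

  open PowerSeries A _≟_
  private module S = RawRing seriesRing

  -- w t i j is the weight of the east step leaving v t i j.
  WeightSystem : Set _
  WeightSystem = (t i : ℕ) → Fin (suc i) → Series

  IsSummable : WeightSystem → Set _
  IsSummable w = ∀ i → Summable (≡.setoid (ℕ × Fin (suc i))) (λ (t , j) → w t i j)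

  eastWeight : WeightSystem → Vertex → Series
  eastWeight w (v t i j) = w t i j

  -- From the index proj₁ (limit 0) on, a path stays in one column and has no
  -- east step, so the weight is the product over the steps before that index.

  seWeight : ∀ {k n} → WeightSystem → SEPath k n → Series
  seWeight w p = big S._*_ S.1# (upTo (proj₁ (limit 0)))
    (λ m → [ const S.1# , const (eastWeight w (at (suc m))) ] (step m))
    where open SEPath p

  ne*Weight : ∀ {k n} → WeightSystem → NE*Path k n → Series
  ne*Weight w p = big S._*_ S.1# (upTo (proj₁ (limit 0)))
    (λ m → [ const S.1# , const (eastWeight w (at m)) ] (step m))
    where open NE*Path p

  -- IsH w n k s: the sum h^w_{n,k} is defined and equal to s.
  IsH : WeightSystem → ℕ → ℕ → Series → Set _
  IsH w n k = HasSum (sePaths k n) (seWeight w)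

  -- IsE w n k s: the sum e^w_{n,k} is defined and equal to s.
  IsE : WeightSystem → ℕ → ℕ → Series → Set _
  IsE w n k = HasSum (ne*Paths k n) (ne*Weight w)

------------------------------------------------------------------------
-- Polynomials in one variable over a field

module Polynomials {c ℓ₁ ℓ₂} (K : HeytingField c ℓ₁ ℓ₂) where

  open HeytingField K

  -- Coefficients in order of increasing degree; trailing zeros are allowed.
  Polynomial : Set c
  Polynomial = List Carrier

  coefficient : Polynomial → ℕ → Carrier
  coefficient []      m       = 0#
  coefficient (c ∷ p) zero    = c
  coefficient (c ∷ p) (suc m) = coefficient p m

  infix  4 _≈ₚ_
  infixl 6 _+ₚ_
  infixl 7 _·ₚ_

  _≈ₚ_ : Rel Polynomial ℓ₁
  p ≈ₚ q = ∀ m → coefficient p m ≈ coefficient q m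

  _+ₚ_ : Polynomial → Polynomial → Polynomial
  []      +ₚ q       = q
  (c ∷ p) +ₚ []      = c ∷ p
  (c ∷ p) +ₚ (d ∷ q) = c + d ∷ (p +ₚ q)

  _·ₚ_ : Carrier → Polynomial → Polynomial
  c ·ₚ p = map (c *_) p

  ∑ₚ≤ : ℕ → (ℕ → Polynomial) → Polynomial
  ∑ₚ≤ n f = big _+ₚ_ [] (upTo (suc n)) f

  HasDegree : Polynomial → ℕ → Set _
  HasDegree p n = coefficient p n # 0# × (∀ m → n < m → coefficient p m ≈ 0#)

------------------------------------------------------------------------
-- Mixed moments and coefficients expressed by lecture hall graph paths

module Setting {a ℓ x c ℓ₁ ℓ₂}
               (A : CommutativeRing a ℓ) {X : Set x} (_≟_ : DecidableEquality X)
               (K : HeytingField c ℓ₁ ℓ₂) where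

  open HeytingField K
  open PowerSeries A _≟_ public using (Series; seriesRing)
  open LectureHall A _≟_ public using (WeightSystem; IsSummable; IsH; IsE)
  open Polynomials K public

  private
    fieldRing : CommutativeRing c ℓ₁
    fieldRing = record { isCommutativeRing = isCommutativeRing }

  open RawSemiringDefinitions (RawRing.rawSemiring (CommutativeRing.rawRing fieldRing)) using (_^_)

  -- ι identifies the ring of power series with a subring of K.
  IsEmbedding : (Series → Carrier) → Set _
  IsEmbedding = RingMorphisms.IsRingMonomorphism seriesRing (CommutativeRing.rawRing fieldRing)

  AreMixedMoments : (p q : ℕ → Polynomial) → (ℕ → ℕ → Carrier) → Set _
  AreMixedMoments p q σ = ∀ n → q n ≈ₚ ∑ₚ≤ n (λ k → σ n k ·ₚ p k)

  AreMixedCoefficients : (p q : ℕ → Polynomial) → (ℕ → ℕ → Carrier) → Set _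
  AreMixedCoefficients p q ν = ∀ n → p n ≈ₚ ∑ₚ≤ n (λ k → ν n k ·ₚ q k)

  MomentsAreH : (Series → Carrier) → (ℕ → ℕ → Carrier) → WeightSystem → Set _
  MomentsAreH ι σ w = ∀ n k → k ≤ n →
    ∃ λ h → IsH w n k h × σ n k ≈ ι h

  CoefficientsAreE : (Series → Carrier) → (ℕ → ℕ → Carrier) → WeightSystem → Set _
  CoefficientsAreE ι ν w = ∀ n k → k ≤ n →
    ∃ λ e → IsE w n k e × ν n k ≈ (- 1#) ^ (n ∸ k) * ι e

{-# OPTIONS --safe #-}

-- For fixed t and j the vertices v^t_{i,j}, i ≥ j, form a line of east steps,
-- and the lines are linearly ordered by height.  Let X_L be the matrix of the
-- weights on the line L.  An SE path goes down through the lines and takes any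
-- number of east steps on each, so (h_{n,k}) is the product of the matrices
-- (1 − X_L)⁻¹; an NE* path goes up and takes at most one east step on each, so
-- ((-1)^{n-k} e_{n,k}) is the product of the 1 − X_L in the opposite order.
-- Hence these two matrices are inverse to each other, as are (σ_{n,k}) and
-- (ν_{n,k}) because the q_n are linearly independent.
--
-- The infinite products are compared one monomial μ at a time: modulo the
-- largest ideal of series on which the coefficient of μ vanishes, the weights
-- above a certain level are zero.

module Submission where

open import Defs
open import Algebra.Apartness.Bundles using (HeytingField)
open import Algebra.Bundles using (CommutativeRing; Monoid; RawRing; Ring)
import Algebra.Definitions.RawSemiring as RawSemiringDefinitions
import Algebra.Morphism.RingMonomorphism as RingMonomorphism
open import Algebra.Morphism.Structures using (module RingMorphisms)
import Algebra.Properties.Ring as RingProperties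
import Algebra.Solver.Ring.NaturalCoefficients.Default as SemiringSolver
open import Algebra.Structures using (IsCommutativeRing)
open import Data.Bool.Base using (Bool; true; false; if_then_else_)
import Data.Bool.Properties as Boolₚ
open import Data.Fin.Base using (Fin; zero; suc; toℕ; inject₁; fromℕ; fromℕ<)
import Data.Fin.Properties as Finₚ
open import Data.Fin.Relation.Unary.Top using (View; view; ‵fromℕ; ‵inj₁; view-fromℕ; view-inject₁)
open import Data.List.Base using (List; []; _∷_; _∷ʳ_; _++_; map; upTo)
open import Data.List.Membership.Propositional using () renaming (_∈_ to _∈ₗ_)
import Data.List.Membership.Propositional.Properties as ∈ₚ
import Data.List.Membership.Setoid as SetoidMembership
import Data.List.Membership.Setoid.Properties as Membershipₚ
open import Data.List.Properties using (foldr-map; map-upTo; upTo-∷ʳ)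
import Data.List.Relation.Unary.All as All
import Data.List.Relation.Unary.AllPairs as AllPairs
open import Data.List.Relation.Unary.Any using (here; there)
import Data.List.Relation.Unary.Unique.Setoid as SetoidUnique
import Data.List.Relation.Unary.Unique.Setoid.Properties as Uniqueₚ
open import Data.Maybe.Base using (Maybe; just; nothing)
open import Data.Maybe.Properties using (just-injective)
open import Data.Nat.Base as ℕ using (ℕ; zero; suc; _≡ᵇ_; _⊔_; _∸_; _≤_; _<_; z≤n; s≤s; z<s; s<s)
import Data.Nat.Properties as ℕₚ
open import Data.Product.Base using (_×_; ∃; _,_; proj₁; proj₂)
open import Data.Product.Properties using () renaming (≡-dec to ×-≡-dec)
open import Data.Sum.Base as Sum using (_⊎_; inj₁; inj₂; [_,_])
open import Function.Base using (_∘_; const)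
open import Function.Bundles using (Inverse)
open import Function.Construct.Symmetry using () renaming (inverse to ↔-sym)
open import Level using (Level; 0ℓ)
open import Relation.Binary.Bundles using (Setoid)
open import Relation.Binary.Core using (Rel)
open import Relation.Binary.Definitions using (Decidable; DecidableEquality; tri<; tri≈; tri>)
open import Relation.Binary.PropositionalEquality as ≡ using (_≡_; _≢_)
open import Relation.Nullary using (¬_; Dec; yes; no; contradiction)

-- Finite sums and products

-- The infinite products are never formed. What is followed is the product of signed e and h over
-- the lines from a given one upwards: raising that line by one cancels the adjacent factors 1 - X_L
-- and (1 - X_L)⁻¹, and above all nonzero weights the product is the identity. Taking the
-- coefficient of μ is not multiplicative, so the recursions along paths cannot be followed for that
-- coefficient alone, but a congruence of rings carries them. The counts therefore live over a raw
-- ring, and one argument is run modulo each μ. Such a congruence is checked on the coefficients of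
-- all left factors of μ, whence the maxima over factorizations when a level bound is chosen. Since
-- paths are infinite, the sums themselves have to be constructed. Paths of both kinds are read
-- upwards from their bottom vertex, and those without east steps after m moves form a finite list.
-- A potential that grows with every move shows that later east steps contribute nothing to the
-- coefficient of μ.

big-upTo : ∀ {c} {C : Set c} (_∙_ : C → C → C) ε n (f : ℕ → C) →
           big _∙_ ε (upTo (suc n)) f ≡ f 0 ∙ big _∙_ ε (upTo n) (f ∘ suc)
big-upTo _∙_ ε n f = ≡.cong (f 0 ∙_)
  (≡.trans (≡.cong (λ is → big _∙_ ε is f) (≡.sym (map-upTo suc n)))
           (foldr-map _ suc ε (upTo n)))

module BigOperators {m ℓ} (M : Monoid m ℓ) where
  open Monoid M
  open import Relation.Binary.Reasoning.Setoid setoid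

  big-cong : ∀ n {f g : ℕ → Carrier} → (∀ i → i < n → f i ≈ g i) →
             big _∙_ ε (upTo n) f ≈ big _∙_ ε (upTo n) g
  big-cong zero    eq = refl
  big-cong (suc n) {f} {g} eq = begin
    big _∙_ ε (upTo (suc n)) f             ≡⟨ big-upTo _∙_ ε n f ⟩
    f 0 ∙ big _∙_ ε (upTo n) (f ∘ suc)     ≈⟨ ∙-cong (eq 0 z<s) (big-cong n (λ i i<n → eq (suc i) (s<s i<n))) ⟩
    g 0 ∙ big _∙_ ε (upTo n) (g ∘ suc)     ≡⟨ big-upTo _∙_ ε n g ⟨
    big _∙_ ε (upTo (suc n)) g             ∎

  big-ε : ∀ n {f : ℕ → Carrier} → (∀ i → i < n → f i ≈ ε) → big _∙_ ε (upTo n) f ≈ ε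
  big-ε zero    eq = refl
  big-ε (suc n) {f} eq = begin
    big _∙_ ε (upTo (suc n)) f             ≡⟨ big-upTo _∙_ ε n f ⟩
    f 0 ∙ big _∙_ ε (upTo n) (f ∘ suc)     ≈⟨ ∙-cong (eq 0 z<s) (big-ε n (λ i i<n → eq (suc i) (s<s i<n))) ⟩
    ε ∙ ε                                  ≈⟨ identityˡ ε ⟩
    ε                                      ∎

  big-extend : ∀ {n N} (f : ℕ → Carrier) → n ≤ N → (∀ k → n ≤ k → f k ≈ ε) →
               big _∙_ ε (upTo N) f ≈ big _∙_ ε (upTo n) f
  big-extend {N = N} f z≤n tail≈ε = big-ε N (λ k _ → tail≈ε k z≤n)
  big-extend {suc n} {suc N} f (s≤s n≤N) tail≈ε = begin
    big _∙_ ε (upTo (suc N)) f             ≡⟨ big-upTo _∙_ ε N f ⟩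
    f 0 ∙ big _∙_ ε (upTo N) (f ∘ suc)     ≈⟨ ∙-congˡ (big-extend (f ∘ suc) n≤N (λ k n≤k → tail≈ε (suc k) (s≤s n≤k))) ⟩
    f 0 ∙ big _∙_ ε (upTo n) (f ∘ suc)     ≡⟨ big-upTo _∙_ ε n f ⟨
    big _∙_ ε (upTo (suc n)) f             ∎

module FiniteSums {r ℓ} (R : CommutativeRing r ℓ) where
  open CommutativeRing R
  open PowerSeries R ℕₚ._≟_ public using (∑; ∑-cong; ∑-map; ∑-++; ∑-swap)
  open BigOperators +-monoid public
    renaming (big-cong to ∑<-cong; big-ε to ∑<-zero; big-extend to ∑-extend)
  open import Relation.Binary.Reasoning.Setoid setoid
  private module Solver = SemiringSolver commutativeSemiring

  ∑-suc : ∀ n (f : ℕ → Carrier) → ∑ (upTo (suc n)) f ≈ f 0 + ∑ (upTo n) (f ∘ suc)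
  ∑-suc n f = reflexive (big-upTo _+_ 0# n f)

  *-distribˡ-∑ : ∀ {i} {I : Set i} c (is : List I) (f : I → Carrier) →
                 c * ∑ is f ≈ ∑ is (λ i → c * f i)
  *-distribˡ-∑ c []       f = zeroʳ c
  *-distribˡ-∑ c (i ∷ is) f = trans (distribˡ c _ _) (+-congˡ (*-distribˡ-∑ c is f))

  *-distribʳ-∑ : ∀ {i} {I : Set i} c (is : List I) (f : I → Carrier) →
                 ∑ is f * c ≈ ∑ is (λ i → f i * c)
  *-distribʳ-∑ c []       f = zeroˡ c
  *-distribʳ-∑ c (i ∷ is) f = trans (distribʳ c _ _) (+-congˡ (*-distribʳ-∑ c is f))

  -- Summation by parts, with the lowering of E⁺ to E and the raising of H⁺ to
  -- H arranged so that no subtraction occurs.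
  ∑-by-parts : ∀ n {E E⁺ H H⁺ x : ℕ → Carrier} c →
               (∀ i → i < n → E i + x i * E⁺ (suc i) ≈ E⁺ i) →
               (0 < n → H 0 ≈ H⁺ 0 + c) →
               (∀ i → suc i < n → H (suc i) ≈ H⁺ (suc i) + x i * H i) →
               E⁺ n ≈ 0# →
               ∑ (upTo n) (λ i → E i * H i) ≈ E⁺ 0 * c + ∑ (upTo n) (λ i → E⁺ i * H⁺ i)
  ∑-by-parts zero {E⁺ = E⁺} c hE h₀ h₊ end = sym (begin
    E⁺ 0 * c + 0# ≈⟨ +-identityʳ _ ⟩
    E⁺ 0 * c      ≈⟨ *-congʳ end ⟩
    0# * c        ≈⟨ zeroˡ c ⟩
    0#            ∎)
  ∑-by-parts (suc n) {E} {E⁺} {H} {H⁺} {x} c hE h₀ h₊ end = begin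
    ∑ (upTo (suc n)) (λ i → E i * H i)
      ≈⟨ ∑-suc n _ ⟩
    E 0 * H 0 + ∑ (upTo n) (λ i → E (suc i) * H (suc i))
      ≈⟨ +-congˡ tail ⟩
    E 0 * H 0 + (E⁺ 1 * (x 0 * H 0) + rest)
      ≈⟨ Solver.solve 5 (λ e h e′ y r → e :* h :+ (e′ :* (y :* h) :+ r)
                                    := (e :+ y :* e′) :* h :+ r) refl _ _ _ _ _ ⟩
    (E 0 + x 0 * E⁺ 1) * H 0 + rest
      ≈⟨ +-congʳ (*-cong (hE 0 z<s) (h₀ z<s)) ⟩
    E⁺ 0 * (H⁺ 0 + c) + rest
      ≈⟨ Solver.solve 4 (λ e h d r → e :* (h :+ d) :+ r := e :* d :+ (e :* h :+ r)) refl _ _ _ _ ⟩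
    E⁺ 0 * c + (E⁺ 0 * H⁺ 0 + rest)
      ≈⟨ +-congˡ (∑-suc n _) ⟨
    E⁺ 0 * c + ∑ (upTo (suc n)) (λ i → E⁺ i * H⁺ i) ∎
    where
    open Solver using (_:+_; _:*_; _:=_)
    rest = ∑ (upTo n) (λ i → E⁺ (suc i) * H⁺ (suc i))
    tail : ∑ (upTo n) (λ i → E (suc i) * H (suc i)) ≈ E⁺ 1 * (x 0 * H 0) + rest
    tail = ∑-by-parts n (x 0 * H 0) (λ i i<n → hE (suc i) (s<s i<n))
             (λ 0<n → h₊ 0 (s<s 0<n)) (λ i i<n → h₊ (suc i) (s<s i<n)) end

  δ : ℕ → ℕ → Carrier
  δ i j = if i ≡ᵇ j then 1# else 0#

  δ-refl : ∀ i → δ i i ≡ 1#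
  δ-refl zero    = ≡.refl
  δ-refl (suc i) = δ-refl i

  δ-≢ : ∀ {i j} → i ≢ j → δ i j ≡ 0#
  δ-≢ {zero}  {zero}  i≢j = contradiction ≡.refl i≢j
  δ-≢ {zero}  {suc j} i≢j = ≡.refl
  δ-≢ {suc i} {zero}  i≢j = ≡.refl
  δ-≢ {suc i} {suc j} i≢j = δ-≢ (i≢j ∘ ≡.cong suc)

  δ-sym : ∀ i j → δ i j ≡ δ j i
  δ-sym zero    zero    = ≡.refl
  δ-sym zero    (suc j) = ≡.refl
  δ-sym (suc i) zero    = ≡.refl
  δ-sym (suc i) (suc j) = δ-sym i j

  ∑-δˡ : ∀ {n k} (f : ℕ → Carrier) → k < n → ∑ (upTo n) (λ i → δ k i * f i) ≈ f k
  ∑-δˡ {suc n} {zero} f _ = begin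
    ∑ (upTo (suc n)) (λ i → δ 0 i * f i)             ≈⟨ ∑-suc n _ ⟩
    1# * f 0 + ∑ (upTo n) (λ i → 0# * f (suc i))     ≈⟨ +-cong (*-identityˡ _) (∑<-zero n (λ i _ → zeroˡ _)) ⟩
    f 0 + 0#                                         ≈⟨ +-identityʳ _ ⟩
    f 0                                              ∎
  ∑-δˡ {suc n} {suc k} f (s≤s k<n) = begin
    ∑ (upTo (suc n)) (λ i → δ (suc k) i * f i)       ≈⟨ ∑-suc n _ ⟩
    0# * f 0 + ∑ (upTo n) (λ i → δ k i * f (suc i))  ≈⟨ +-cong (zeroˡ _) (∑-δˡ (f ∘ suc) k<n) ⟩
    0# + f (suc k)                                   ≈⟨ +-identityˡ _ ⟩
    f (suc k)                                        ∎

  ∑-δʳ : ∀ {n k} (f : ℕ → Carrier) → k < n → ∑ (upTo n) (λ i → f i * δ i k) ≈ f k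
  ∑-δʳ {n} {k} f k<n = trans
    (∑-cong (upTo n) (λ i → trans (*-comm _ _) (*-congʳ (reflexive (δ-sym i k)))))
    (∑-δˡ f k<n)

  mulTo : ℕ → (A B : ℕ → ℕ → Carrier) → ℕ → ℕ → Carrier
  mulTo n A B i j = ∑ (upTo n) (λ k → A i k * B k j)

  -- A = A(BC) = (AB)C = C for finite sections. In both directions of the theorem `B` is the matrix
  -- that the hypothesis identifies.
  leftInverse≈rightInverse : ∀ n {A B C : ℕ → ℕ → Carrier} →
    (∀ i j → i < n → j < n → mulTo n A B i j ≈ δ i j) →
    (∀ i j → i < n → j < n → mulTo n B C i j ≈ δ i j) →
    ∀ i j → i < n → j < n → A i j ≈ C i j
  leftInverse≈rightInverse n {A} {B} {C} AB BC i j i<n j<n = begin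
    A i j
      ≈⟨ ∑-δʳ (A i) j<n ⟨
    ∑ (upTo n) (λ k → A i k * δ k j)
      ≈⟨ ∑<-cong n (λ k k<n → *-congˡ (BC k j k<n j<n)) ⟨
    ∑ (upTo n) (λ k → A i k * ∑ (upTo n) (λ l → B k l * C l j))
      ≈⟨ ∑-cong (upTo n) (λ k → *-distribˡ-∑ (A i k) (upTo n) _) ⟩
    ∑ (upTo n) (λ k → ∑ (upTo n) (λ l → A i k * (B k l * C l j)))
      ≈⟨ ∑-swap (upTo n) (upTo n) _ ⟩
    ∑ (upTo n) (λ l → ∑ (upTo n) (λ k → A i k * (B k l * C l j)))
      ≈⟨ ∑-cong (upTo n) (λ l → ∑-cong (upTo n) (λ k → sym (*-assoc _ _ _))) ⟩
    ∑ (upTo n) (λ l → ∑ (upTo n) (λ k → A i k * B k l * C l j))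
      ≈⟨ ∑-cong (upTo n) (λ l → *-distribʳ-∑ (C l j) (upTo n) _) ⟨
    ∑ (upTo n) (λ l → ∑ (upTo n) (λ k → A i k * B k l) * C l j)
      ≈⟨ ∑<-cong n (λ l l<n → *-congʳ (AB i l i<n l<n)) ⟩
    ∑ (upTo n) (λ l → δ i l * C l j)
      ≈⟨ ∑-δˡ (λ l → C l j) i<n ⟩
    C i j ∎

  ∑-last : ∀ n (f : ℕ → Carrier) → ∑ (upTo (suc n)) f ≈ ∑ (upTo n) f + f n
  ∑-last n f = begin
    ∑ (upTo (suc n)) f            ≡⟨ ≡.cong (λ is → ∑ is f) (≡.sym (upTo-∷ʳ n)) ⟩
    ∑ (upTo n ∷ʳ n) f             ≈⟨ ∑-++ (upTo n) (n ∷ []) f ⟩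
    ∑ (upTo n) f + (f n + 0#)     ≈⟨ +-congˡ (+-identityʳ _) ⟩
    ∑ (upTo n) f + f n            ∎

  -- Mixed moments and coefficients mean something only for `k ≤ n`; zeros above the diagonal turn
  -- them into matrices that can be multiplied over a common range.
  lower : (ℕ → ℕ → Carrier) → ℕ → ℕ → Carrier
  lower M n k with k ℕₚ.≤? n
  ... | yes _ = M n k
  ... | no  _ = 0#

  lower-≤ : ∀ M {n k} → k ≤ n → lower M n k ≡ M n k
  lower-≤ M {n} {k} k≤n with k ℕₚ.≤? n
  ... | yes _   = ≡.refl
  ... | no  k≰n = contradiction k≤n k≰n

  lower-> : ∀ M {n k} → n < k → lower M n k ≡ 0#
  lower-> M {n} {k} n<k with k ℕₚ.≤? n
  ... | yes k≤n = contradiction k≤n (ℕₚ.<⇒≱ n<k)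
  ... | no  _   = ≡.refl

-- Expansions in sequences of polynomials

module PolynomialSequences {c ℓ₁ ℓ₂} (K : HeytingField c ℓ₁ ℓ₂) where
  open HeytingField K
  open Polynomials K

  fieldRing : CommutativeRing c ℓ₁
  fieldRing = record { isCommutativeRing = isCommutativeRing }

  open FiniteSums fieldRing
  open RingProperties (CommutativeRing.ring fieldRing) using (+-cancelʳ; -0#≈0#)
  open import Relation.Binary.Reasoning.Setoid setoid

  coefficient-+ : ∀ p q m → coefficient (p +ₚ q) m ≈ coefficient p m + coefficient q m
  coefficient-+ []      q       m       = sym (+-identityˡ _)
  coefficient-+ (c ∷ p) []      m       = sym (+-identityʳ _)
  coefficient-+ (c ∷ p) (d ∷ q) zero    = refl
  coefficient-+ (c ∷ p) (d ∷ q) (suc m) = coefficient-+ p q m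

  coefficient-· : ∀ a p m → coefficient (a ·ₚ p) m ≈ a * coefficient p m
  coefficient-· a []      m       = sym (zeroʳ a)
  coefficient-· a (c ∷ p) zero    = refl
  coefficient-· a (c ∷ p) (suc m) = coefficient-· a p m

  coefficient-∑ : ∀ {i} {I : Set i} (is : List I) (f : I → Polynomial) m →
                  coefficient (big _+ₚ_ [] is f) m ≈ ∑ is (λ i → coefficient (f i) m)
  coefficient-∑ []       f m = refl
  coefficient-∑ (i ∷ is) f m =
    trans (coefficient-+ (f i) _ m) (+-congˡ (coefficient-∑ is f m))

  -- Apartness from zero yields an inverse of the difference of `x` and zero, which has to be
  -- rewritten to `x` before it can be used.
  *-cancelʳ-# : ∀ {x a b} → x # 0# → a * x ≈ b * x → a ≈ b
  *-cancelʳ-# {x} {a} {b} x#0 eq with #⇒invertible x#0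
  ... | x⁻¹ , _ , inv = begin
    a              ≈⟨ cancel a ⟨
    a * x * x⁻¹    ≈⟨ *-congʳ eq ⟩
    b * x * x⁻¹    ≈⟨ cancel b ⟩
    b              ∎
    where
    cancel : ∀ d → d * x * x⁻¹ ≈ d
    cancel d = begin
      d * x * x⁻¹          ≈⟨ *-assoc d x x⁻¹ ⟩
      d * (x * x⁻¹)        ≈⟨ *-congˡ (*-congʳ (trans (+-congˡ -0#≈0#) (+-identityʳ x))) ⟨
      d * ((x - 0#) * x⁻¹) ≈⟨ *-congˡ inv ⟩
      d * 1#               ≈⟨ *-identityʳ d ⟩
      d                    ∎

  module _ (q : ℕ → Polynomial) (deg : ∀ n → HasDegree (q n) n) where

    leading-coefficient : ∀ N (a : ℕ → Carrier) →
      ∑ (upTo (suc N)) (λ l → a l * coefficient (q l) N) ≈ a N * coefficient (q N) N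
    leading-coefficient N a = begin
      ∑ (upTo (suc N)) (λ l → a l * coefficient (q l) N)
        ≈⟨ ∑-last N _ ⟩
      ∑ (upTo N) (λ l → a l * coefficient (q l) N) + a N * coefficient (q N) N
        ≈⟨ +-congʳ (∑<-zero N (λ l l<N → trans (*-congˡ (proj₂ (deg l) N l<N)) (zeroʳ _))) ⟩
      0# + a N * coefficient (q N) N
        ≈⟨ +-identityˡ _ ⟩
      a N * coefficient (q N) N ∎

    -- Back substitution: in degree `N` only the last polynomial contributes, so the top
    -- coefficients agree; they cancel, and the shorter combinations are compared.
    combination-injective : ∀ N {a b : ℕ → Carrier} →
      (∀ m → ∑ (upTo N) (λ l → a l * coefficient (q l) m)
             ≈ ∑ (upTo N) (λ l → b l * coefficient (q l) m)) →
      ∀ l → l < N → a l ≈ b l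
    combination-injective (suc N) {a} {b} eq l l<1+N = split (l ℕₚ.≟ N)
      where
      top : a N ≈ b N
      top = *-cancelʳ-# (proj₁ (deg N))
        (trans (sym (leading-coefficient N a)) (trans (eq N) (leading-coefficient N b)))
      split : Dec (l ≡ N) → a l ≈ b l
      split (yes ≡.refl) = top
      split (no l≢N)     = combination-injective N
        (λ m → +-cancelʳ (b N * coefficient (q N) m) _ _ (begin
          ∑ (upTo N) (λ l → a l * coefficient (q l) m) + b N * coefficient (q N) m
            ≈⟨ +-congˡ (*-congʳ top) ⟨
          ∑ (upTo N) (λ l → a l * coefficient (q l) m) + a N * coefficient (q N) m
            ≈⟨ ∑-last N _ ⟨
          ∑ (upTo (suc N)) (λ l → a l * coefficient (q l) m)
            ≈⟨ eq m ⟩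
          ∑ (upTo (suc N)) (λ l → b l * coefficient (q l) m)
            ≈⟨ ∑-last N _ ⟩
          ∑ (upTo N) (λ l → b l * coefficient (q l) m) + b N * coefficient (q N) m ∎))
        l (ℕₚ.≤∧≢⇒< (ℕ.s≤s⁻¹ l<1+N) l≢N)

  expansion : ∀ (r s : ℕ → Polynomial) M → (∀ n → r n ≈ₚ ∑ₚ≤ n (λ k → M n k ·ₚ s k)) →
              ∀ {n N} → n < N → ∀ m →
              coefficient (r n) m ≈ ∑ (upTo N) (λ k → lower M n k * coefficient (s k) m)
  expansion r s M r≈ {n} {N} n<N m = begin
    coefficient (r n) m
      ≈⟨ r≈ n m ⟩
    coefficient (∑ₚ≤ n (λ k → M n k ·ₚ s k)) m
      ≈⟨ coefficient-∑ (upTo (suc n)) (λ k → M n k ·ₚ s k) m ⟩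
    ∑ (upTo (suc n)) (λ k → coefficient (M n k ·ₚ s k) m)
      ≈⟨ ∑<-cong (suc n) (λ k k≤n → trans (coefficient-· (M n k) (s k) m)
           (*-congʳ (reflexive (≡.sym (lower-≤ M (ℕ.s≤s⁻¹ k≤n)))))) ⟩
    ∑ (upTo (suc n)) (λ k → lower M n k * coefficient (s k) m)
      ≈⟨ ∑-extend _ n<N (λ k n<k → trans (*-congʳ (reflexive (lower-> M n<k))) (zeroˡ _)) ⟨
    ∑ (upTo N) (λ k → lower M n k * coefficient (s k) m) ∎

  -- Expanding each `p k` in the `q l` gives `q i` the coordinates in row `i` of the product; by
  -- linear independence these are the trivial coordinates of `q i`.
  moments*coefficients : ∀ (p q : ℕ → Polynomial) σ ν → (∀ n → HasDegree (q n) n) →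
    (∀ n → q n ≈ₚ ∑ₚ≤ n (λ k → σ n k ·ₚ p k)) →
    (∀ n → p n ≈ₚ ∑ₚ≤ n (λ k → ν n k ·ₚ q k)) →
    ∀ N i j → i < N → j < N → mulTo N (lower σ) (lower ν) i j ≈ δ i j
  moments*coefficients p q σ ν deg q≈ p≈ N i j i<N = combination-injective q deg N (λ m → begin
    ∑ (upTo N) (λ l → mulTo N S V i l * x m l)
      ≈⟨ ∑-cong (upTo N) (λ l → *-distribʳ-∑ (x m l) (upTo N) _) ⟩
    ∑ (upTo N) (λ l → ∑ (upTo N) (λ k → S i k * V k l * x m l))
      ≈⟨ ∑-swap (upTo N) (upTo N) _ ⟩
    ∑ (upTo N) (λ k → ∑ (upTo N) (λ l → S i k * V k l * x m l))
      ≈⟨ ∑-cong (upTo N) (λ k → ∑-cong (upTo N) (λ l → *-assoc _ _ _)) ⟩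
    ∑ (upTo N) (λ k → ∑ (upTo N) (λ l → S i k * (V k l * x m l)))
      ≈⟨ ∑-cong (upTo N) (λ k → *-distribˡ-∑ (S i k) (upTo N) _) ⟨
    ∑ (upTo N) (λ k → S i k * ∑ (upTo N) (λ l → V k l * x m l))
      ≈⟨ ∑<-cong N (λ k k<N → *-congˡ (expansion p q ν p≈ k<N m)) ⟨
    ∑ (upTo N) (λ k → S i k * coefficient (p k) m)
      ≈⟨ expansion q p σ q≈ i<N m ⟨
    x m i
      ≈⟨ ∑-δˡ (x m) i<N ⟨
    ∑ (upTo N) (λ l → δ i l * x m l) ∎) j
    where
    S V : ℕ → ℕ → Carrier
    S = lower σ
    V = lower ν
    x : ℕ → ℕ → Carrier
    x m l = coefficient (q l) m

-- Paths with two kinds of moves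

-- The moves common to SE paths read backwards from their end and NE* paths:
-- a vertical step is always possible, an east step only sometimes.
record Automaton : Set₁ where
  field
    State        : Set
    _≟ₛ_         : DecidableEquality State
    columnOf     : State → ℕ
    north        : State → State
    side         : State → Maybe State
    north-column : ∀ s → columnOf (north s) ≡ columnOf s
    side-column  : ∀ {s s′} → side s ≡ just s′ → columnOf s′ ≢ columnOf s

module Paths (𝒜 : Automaton) (k : ℕ) where
  open Automaton 𝒜

  -- Only the columns are required to settle. From then on every move is north, so in the lecture
  -- hall graph the levels tend to infinity by themselves (`climbing-limit`).
  record Path (s : State) : Set where
    field
      seq     : ℕ → State
      begins  : seq 0 ≡ s
      moves   : ∀ m → seq (suc m) ≡ north (seq m) ⊎ side (seq m) ≡ just (seq (suc m))
      settles : ∃ λ M → ∀ m → M ≤ m → columnOf (seq m) ≡ k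

    SideStep : ℕ → Set
    SideStep m = side (seq m) ≡ just (seq (suc m))

  open Path public

  pathSetoid : State → Setoid 0ℓ 0ℓ
  pathSetoid s = record
    { Carrier       = Path s
    ; _≈_           = λ p p′ → ∀ m → seq p m ≡ seq p′ m
    ; isEquivalence = record
      { refl  = λ _ → ≡.refl
      ; sym   = λ e m → ≡.sym (e m)
      ; trans = λ e e′ m → ≡.trans (e m) (e′ m) } }

  infix 4 _≗ₚ_
  _≗ₚ_ : ∀ {s} → Path s → Path s → Set
  _≗ₚ_ {s} = Setoid._≈_ (pathSetoid s)

  -- The column separates the two kinds of move. Hence the constructor stored in `moves`, from which
  -- weights are read, is determined by the states.
  north≢side : ∀ {s s′ s″} → s′ ≡ north s → side s ≡ just s″ → s′ ≢ s″
  north≢side {s} ≡.refl eq ≡.refl = side-column eq (north-column s)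

  north-late : ∀ {s} (p : Path s) m → proj₁ (settles p) ≤ m → seq p (suc m) ≡ north (seq p m)
  north-late p m M≤m with moves p m
  ... | inj₁ eq = eq
  ... | inj₂ eq = contradiction
    (≡.trans (proj₂ (settles p) (suc m) (ℕₚ.m≤n⇒m≤1+n M≤m)) (≡.sym (proj₂ (settles p) m M≤m)))
    (side-column eq)

  agree-late : ∀ {s} (p p′ : Path s) M → proj₁ (settles p) ≤ M → proj₁ (settles p′) ≤ M →
               (∀ {m} → m < suc M → seq p m ≡ seq p′ m) → p ≗ₚ p′
  agree-late p p′ M P≤M P′≤M eq zero = eq z<s
  agree-late p p′ M P≤M P′≤M eq (suc m) with suc m ℕₚ.≤? M
  ... | yes m<M = eq (s≤s m<M)
  ... | no  m≮M = begin
    seq p (suc m)     ≡⟨ north-late p m (ℕₚ.≤-trans P≤M M≤m) ⟩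
    north (seq p m)   ≡⟨ ≡.cong north (agree-late p p′ M P≤M P′≤M eq m) ⟩
    north (seq p′ m)  ≡⟨ north-late p′ m (ℕₚ.≤-trans P′≤M M≤m) ⟨
    seq p′ (suc m)    ∎
    where
    open ≡.≡-Reasoning
    M≤m = ℕ.s≤s⁻¹ (ℕₚ.≰⇒> m≮M)

  -- Two paths that agree until both have settled are forced north together, so comparing finitely
  -- many states decides equality. Uniqueness of sums over paths rests on this.
  _≟ₚ_ : ∀ {s} → Decidable (_≗ₚ_ {s})
  p ≟ₚ p′ with ℕₚ.allUpTo? (λ m → seq p m ≟ₛ seq p′ m) (suc (proj₁ (settles p) ⊔ proj₁ (settles p′)))
  ... | yes eq = yes (agree-late p p′ _ (ℕₚ.m≤m⊔n _ _) (ℕₚ.m≤n⊔m _ _) eq)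
  ... | no ¬eq = no (λ eq → ¬eq (λ {m} _ → eq m))

  straight : ∀ s → columnOf s ≡ k → Path s
  straight s eq = record
    { seq = climb ; begins = ≡.refl ; moves = λ _ → inj₁ ≡.refl ; settles = 0 , λ m _ → stays m }
    where
    climb : ℕ → State
    climb zero    = s
    climb (suc m) = north (climb m)
    stays : ∀ m → columnOf (climb m) ≡ k
    stays zero    = eq
    stays (suc m) = ≡.trans (north-column (climb m)) (stays m)

  cons : ∀ {s s′} → s′ ≡ north s ⊎ side s ≡ just s′ → Path s′ → Path s
  cons {s} {s′} move p = record
    { seq     = λ { zero → s ; (suc m) → seq p m }
    ; begins  = ≡.refl
    ; moves   = λ { zero    → ≡.subst (λ t → t ≡ north s ⊎ side s ≡ just t) (≡.sym (begins p)) move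
                  ; (suc m) → moves p m }
    ; settles = suc (proj₁ (settles p)) , λ { (suc m) (s≤s le) → proj₂ (settles p) m le } }

  tail : ∀ {s s′} (p : Path s) → seq p 1 ≡ s′ → Path s′
  tail p eq = record
    { seq     = seq p ∘ suc
    ; begins  = eq
    ; moves   = moves p ∘ suc
    ; settles = proj₁ (settles p) , λ m le → proj₂ (settles p) (suc m) (ℕₚ.m≤n⇒m≤1+n le) }

  cons-cong : ∀ {s s′} (move : s′ ≡ north s ⊎ side s ≡ just s′) {p p′ : Path s′} →
              p ≗ₚ p′ → cons move p ≗ₚ cons move p′
  cons-cong move eq zero    = ≡.refl
  cons-cong move eq (suc m) = eq m

  cons-tail : ∀ {s s′} (move : s′ ≡ north s ⊎ side s ≡ just s′) (p : Path s) (eq : seq p 1 ≡ s′) →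
              p ≗ₚ cons move (tail p eq)
  cons-tail move p eq zero    = begins p
  cons-tail move p eq (suc m) = ≡.refl

  module _ {s : State} where
    open SetoidMembership (pathSetoid s) public using (_∈_)

  ∈-cons : ∀ {s s′} (move : s′ ≡ north s ⊎ side s ≡ just s′) {ps} (p : Path s) (eq : seq p 1 ≡ s′) →
           tail p eq ∈ ps → p ∈ map (cons move) ps
  ∈-cons {s} {s′} move {ps} p eq tail∈ = Membershipₚ.∈-resp-≈ (pathSetoid s)
    {map (cons move) ps} {cons move (tail p eq)} {p} (λ m → ≡.sym (cons-tail move p eq m))
    (Membershipₚ.∈-map⁺ (pathSetoid s′) (pathSetoid s) {f = cons move}
      (λ {p} {p′} → cons-cong move {p} {p′}) {tail p eq} tail∈)

  ∈-cons⁻ : ∀ {s s′} (move : s′ ≡ north s ⊎ side s ≡ just s′) {ps} {p : Path s} →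
            p ∈ map (cons move) ps → seq p 1 ≡ s′
  ∈-cons⁻ {s} {s′} move {ps} {p} p∈
    with Membershipₚ.∈-map⁻ (pathSetoid s′) (pathSetoid s) {p} {ps} {cons move} p∈
  ... | q , _ , p≈ = ≡.trans (p≈ 1) (begins q)

  sidePaths : ∀ {s} t → side s ≡ t → (∀ s′ → List (Path s′)) → List (Path s)
  sidePaths nothing   eq ps = []
  sidePaths (just s′) eq ps = map (cons (inj₂ eq)) (ps s′)

  straightPaths : ∀ {s} → Dec (columnOf s ≡ k) → List (Path s)
  straightPaths (yes eq) = straight _ eq ∷ []
  straightPaths (no _)   = []

  -- The paths without east steps from the m-th step on.
  paths : ℕ → ∀ s → List (Path s)
  paths zero    s = straightPaths (columnOf s ℕₚ.≟ k)
  paths (suc m) s = map (cons (inj₁ ≡.refl)) (paths m (north s)) ++ sidePaths (side s) ≡.refl (paths m)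

  -- Beyond the settling bound all moves are north, so the search for an east step is finite and
  -- yields an actual index.
  sides-or-straight : ∀ {s} (p : Path s) → (∃ λ m → SideStep p m) ⊎ (∀ m → seq p (suc m) ≡ north (seq p m))
  sides-or-straight p with ℕₚ.allUpTo? (λ m → seq p (suc m) ≟ₛ north (seq p m)) (proj₁ (settles p))
  ... | yes eq = inj₂ all
    where
    all : ∀ m → seq p (suc m) ≡ north (seq p m)
    all m with m ℕₚ.<? proj₁ (settles p)
    ... | yes m<M = eq m<M
    ... | no  m≮M = north-late p m (ℕₚ.≮⇒≥ m≮M)
  ... | no ¬eq = inj₁ (find (proj₁ (settles p)) ¬eq)
    where
    find : ∀ M → ¬ (∀ {m} → m < M → seq p (suc m) ≡ north (seq p m)) → ∃ λ m → SideStep p m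
    find zero    ¬eq = contradiction (λ ()) ¬eq
    find (suc M) ¬eq with moves p M
    ... | inj₂ eq = M , eq
    ... | inj₁ eq = find M (λ below → ¬eq (λ {m} m<1+M → extend below m m<1+M))
      where
      extend : (∀ {m} → m < M → seq p (suc m) ≡ north (seq p m)) →
               ∀ m → m < suc M → seq p (suc m) ≡ north (seq p m)
      extend below m m<1+M with m ℕₚ.≟ M
      ... | yes ≡.refl = eq
      ... | no  m≢M    = below (ℕₚ.≤∧≢⇒< (ℕ.s≤s⁻¹ m<1+M) m≢M)

  ∈-sidePaths : ∀ {s s′} {ps : ∀ s → List (Path s)} (p : Path s) t (eq : side s ≡ t) (eq′ : t ≡ just s′)
                (q : seq p 1 ≡ s′) → tail p q ∈ ps s′ → p ∈ sidePaths t eq ps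
  ∈-sidePaths p (just _) eq ≡.refl q tail∈ = ∈-cons (inj₂ eq) p q tail∈

  -- The alternative to membership is an explicit late east step rather than a mere negation,
  -- because that step is what makes the weight of the path vanish.
  paths-complete : ∀ m {s} (p : Path s) → (p ∈ paths m s) ⊎ (∃ λ i → m ≤ i × SideStep p i)
  paths-complete zero {s} p with sides-or-straight p
  ... | inj₁ (i , eq) = inj₂ (i , z≤n , eq)
  ... | inj₂ up = inj₁ (member (columnOf s ℕₚ.≟ k))
    where
    columns : ∀ m → columnOf (seq p m) ≡ columnOf s
    columns zero    = ≡.cong columnOf (begins p)
    columns (suc m) = ≡.trans (≡.cong columnOf (up m)) (≡.trans (north-column _) (columns m))
    climbs : ∀ (eq : columnOf s ≡ k) m → seq p m ≡ seq (straight s eq) m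
    climbs eq zero    = begins p
    climbs eq (suc m) = ≡.trans (up m) (≡.cong north (climbs eq m))
    member : (d : Dec (columnOf s ≡ k)) → p ∈ straightPaths d
    member (yes eq) = here (climbs eq)
    member (no neq) = contradiction
      (≡.trans (≡.sym (columns _)) (proj₂ (settles p) (proj₁ (settles p)) ℕₚ.≤-refl)) neq
  paths-complete (suc m) {s} p with moves p 0
  ... | inj₁ eq = inNorth (paths-complete m (tail p eq′))
    where
    eq′ : seq p 1 ≡ north s
    eq′ = ≡.trans eq (≡.cong north (begins p))
    inNorth : (tail p eq′ ∈ paths m (north s)) ⊎ (∃ λ i → m ≤ i × SideStep (tail p eq′) i) →
              (p ∈ paths (suc m) s) ⊎ (∃ λ i → suc m ≤ i × SideStep p i)
    inNorth (inj₂ (i , m≤i , e)) = inj₂ (suc i , s≤s m≤i , e)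
    inNorth (inj₁ tail∈) = inj₁ (Membershipₚ.∈-++⁺ˡ (pathSetoid s) {p}
      (∈-cons (inj₁ ≡.refl) p eq′ tail∈))
  ... | inj₂ eq = inSide (paths-complete m (tail p ≡.refl))
    where
    inSide : (tail p ≡.refl ∈ paths m (seq p 1)) ⊎ (∃ λ i → m ≤ i × SideStep (tail p ≡.refl) i) →
             (p ∈ paths (suc m) s) ⊎ (∃ λ i → suc m ≤ i × SideStep p i)
    inSide (inj₂ (i , m≤i , e)) = inj₂ (suc i , s≤s m≤i , e)
    inSide (inj₁ tail∈) = inj₁ (Membershipₚ.∈-++⁺ʳ (pathSetoid s) {p} (map (cons (inj₁ ≡.refl)) (paths m (north s)))
      (∈-sidePaths {ps = paths m} p (side s) ≡.refl
        (≡.trans (≡.cong side (≡.sym (begins p))) eq) ≡.refl tail∈))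

  Unique : ∀ {s} → List (Path s) → Set
  Unique {s} = SetoidUnique.Unique (pathSetoid s)

  cons-unique : ∀ {s s′} (move : s′ ≡ north s ⊎ side s ≡ just s′) {ps : List (Path s′)} →
                Unique ps → Unique (map (cons move) ps)
  cons-unique {s} {s′} move = Uniqueₚ.map⁺ (pathSetoid s′) (pathSetoid s) (λ eq m → eq (suc m))

  sidePaths-unique : ∀ {s} t (eq : side s ≡ t) {ps} → (∀ s′ → Unique (ps s′)) → Unique (sidePaths t eq ps)
  sidePaths-unique nothing   eq ps! = AllPairs.[]
  sidePaths-unique (just s′) eq ps! = cons-unique (inj₂ eq) (ps! s′)

  sidePaths-side : ∀ {s} t (eq : side s ≡ t) {ps} {p : Path s} → p ∈ sidePaths t eq ps →
                   ∃ λ s′ → side s ≡ just s′ × seq p 1 ≡ s′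
  sidePaths-side (just s′) eq {ps} {p} p∈ = s′ , eq , ∈-cons⁻ (inj₂ eq) {ps s′} {p} p∈

  paths-unique : ∀ m s → Unique (paths m s)
  paths-unique zero s with columnOf s ℕₚ.≟ k
  ... | yes _ = All.[] AllPairs.∷ AllPairs.[]
  ... | no  _ = AllPairs.[]
  paths-unique (suc m) s = Uniqueₚ.++⁺ (pathSetoid s)
    (cons-unique (inj₁ ≡.refl) (paths-unique m (north s)))
    (sidePaths-unique (side s) ≡.refl (paths-unique m))
    -- The two halves are disjoint: the second state of a path reveals its first move.
    λ {p} (p∈north , p∈side) →
      let _ , eq , p₁≡ = sidePaths-side (side s) ≡.refl {paths m} {p} p∈side
      in north≢side (∈-cons⁻ (inj₁ ≡.refl) {paths m (north s)} {p} p∈north) eq p₁≡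

-- A path that has taken m steps is at a state with Φ ≥ m, hence at a high level:
-- this is what bounds the number of steps that matter for a coefficient.
record Growth (𝒜 : Automaton) : Set₁ where
  open Automaton 𝒜
  field
    Ok       : State → Set
    ok-north : ∀ {s} → Ok s → Ok (north s)
    ok-side  : ∀ {s s′} → Ok s → side s ≡ just s′ → Ok s′
    Φ        : State → ℕ
    Φ-north  : ∀ {s} → Ok s → Φ s < Φ (north s)
    Φ-side   : ∀ {s s′} → Ok s → side s ≡ just s′ → Φ s < Φ s′

-- Weighted counting of paths

RingLaws : ∀ {c ℓ ℓ′} (R : RawRing c ℓ) → Rel (RawRing.Carrier R) ℓ′ → Set _
RingLaws R _≋_ = IsCommutativeRing _≋_ _+_ _*_ -_ 0# 1#
  where open RawRing R

-- Counts are defined over the raw ring, so that the same series can be studied under equality and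
-- under the congruence of each monomial; these are different choices of `_≋_` in `Laws`.
module Counting (𝒜 : Automaton) (k : ℕ) {c ℓ} (R : RawRing c ℓ)
                (weight : Automaton.State 𝒜 → Automaton.State 𝒜 → RawRing.Carrier R) where
  open Automaton 𝒜
  open Paths 𝒜 k
  open RawRing R hiding (_≈_)

  stepWeight : ∀ {s} → Path s → ℕ → Carrier
  stepWeight p m = [ const 1# , const (weight (seq p m) (seq p (suc m))) ] (moves p m)

  pathWeight : ∀ {s} → Path s → Carrier
  pathWeight p = big _*_ 1# (upTo (proj₁ (settles p))) (stepWeight p)

  onSide : State → Maybe State → (State → Carrier) → Carrier
  onSide s nothing   g = 0#
  onSide s (just s′) g = weight s s′ * g s′

  -- The total weight of the paths without east steps from the m-th step on.
  count : ℕ → State → Carrier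
  count zero    s = if columnOf s ≡ᵇ k then 1# else 0#
  count (suc m) s = count m (north s) + onSide s (side s) (count m)

  stepWeight-north : ∀ {s} (p : Path s) m → seq p (suc m) ≡ north (seq p m) → stepWeight p m ≡ 1#
  stepWeight-north p m eq with moves p m
  ... | inj₁ _  = ≡.refl
  ... | inj₂ e = contradiction ≡.refl (north≢side eq e)

  stepWeight-side : ∀ {s} (p : Path s) m → SideStep p m →
                    stepWeight p m ≡ weight (seq p m) (seq p (suc m))
  stepWeight-side p m e with moves p m
  ... | inj₁ eq = contradiction ≡.refl (north≢side eq e)
  ... | inj₂ _  = ≡.refl

  stepWeight-cong : ∀ {s} {p p′ : Path s} → p ≗ₚ p′ → ∀ m → stepWeight p m ≡ stepWeight p′ m
  stepWeight-cong {p = p} {p′} eq m with moves p m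
  ... | inj₁ e = ≡.sym (stepWeight-north p′ m
    (≡.trans (≡.sym (eq (suc m))) (≡.trans e (≡.cong north (eq m)))))
  ... | inj₂ e = ≡.trans (≡.cong₂ weight (eq m) (eq (suc m))) (≡.sym (stepWeight-side p′ m
    (≡.trans (≡.cong side (≡.sym (eq m))) (≡.trans e (≡.cong just (eq (suc m)))))))

  module Laws {ℓ′} {_≋_ : Rel Carrier ℓ′} (isCR : RingLaws R _≋_) where

    ring : CommutativeRing c ℓ′
    ring = record { isCommutativeRing = isCR }

    open CommutativeRing ring hiding (_+_; _*_; -_; 0#; 1#; Carrier; ring)
    open FiniteSums ring using (∑; ∑-cong; ∑-map; ∑-++; *-distribˡ-∑; δ; δ-refl; δ-≢)
    open BigOperators *-monoid
    open import Relation.Binary.Reasoning.Setoid setoid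

    pathWeight-beyond : ∀ {s} (p : Path s) {M} → proj₁ (settles p) ≤ M →
                        big _*_ 1# (upTo M) (stepWeight p) ≈ pathWeight p
    pathWeight-beyond p M≤ = big-extend (stepWeight p) M≤
      (λ m le → reflexive (stepWeight-north p m (north-late p m le)))

    -- Equal paths may carry different settling bounds. Both products are extended to the larger
    -- one, where all additional factors come from north steps.
    pathWeight-cong : ∀ {s} {p p′ : Path s} → p ≗ₚ p′ → pathWeight p ≈ pathWeight p′
    pathWeight-cong {p = p} {p′} eq = begin
      pathWeight p                          ≈⟨ pathWeight-beyond p (ℕₚ.m≤m⊔n _ _) ⟨
      big _*_ 1# (upTo M) (stepWeight p)    ≈⟨ big-cong M (λ m _ → reflexive (stepWeight-cong {p = p} {p′} eq m)) ⟩
      big _*_ 1# (upTo M) (stepWeight p′)   ≈⟨ pathWeight-beyond p′ (ℕₚ.m≤n⊔m (proj₁ (settles p)) _) ⟩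
      pathWeight p′                         ∎
      where M = proj₁ (settles p) ⊔ proj₁ (settles p′)

    big-zero : ∀ {n i} (f : ℕ → Carrier) → i < n → f i ≈ 0# → big _*_ 1# (upTo n) f ≈ 0#
    big-zero {suc n} {zero}  f _ eq = trans (reflexive (big-upTo _*_ 1# n f)) (trans (*-congʳ eq) (zeroˡ _))
    big-zero {suc n} {suc i} f (s≤s i<n) eq =
      trans (reflexive (big-upTo _*_ 1# n f)) (trans (*-congˡ (big-zero (f ∘ suc) i<n eq)) (zeroʳ _))

    pathWeight-zero : ∀ {s} (p : Path s) {i} → SideStep p i →
                      weight (seq p i) (seq p (suc i)) ≈ 0# → pathWeight p ≈ 0#
    pathWeight-zero p {i} e eq = begin
      pathWeight p                         ≈⟨ pathWeight-beyond p (ℕₚ.m≤n⊔m (suc i) _) ⟨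
      big _*_ 1# (upTo (suc i ⊔ proj₁ (settles p))) (stepWeight p)
                                           ≈⟨ big-zero (stepWeight p) (ℕₚ.m≤m⊔n (suc i) (proj₁ (settles p)))
                                                (trans (reflexive (stepWeight-side p i e)) eq) ⟩
      0#                                   ∎

    ∑-straightPaths : ∀ {s} (d : Dec (columnOf s ≡ k)) → ∑ (straightPaths d) pathWeight ≈ δ (columnOf s) k
    ∑-straightPaths {s} (yes eq) = trans (+-identityʳ 1#) (reflexive
      (≡.sym (≡.trans (≡.cong (λ i → δ i k) eq) (δ-refl k))))
    ∑-straightPaths (no neq) = reflexive (≡.sym (δ-≢ neq))

    pathWeight-north : ∀ {s} (p : Path (north s)) → pathWeight (cons (inj₁ ≡.refl) p) ≈ pathWeight p
    pathWeight-north {s} p = begin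
      pathWeight p′                  ≡⟨ big-upTo _*_ 1# (proj₁ (settles p)) (stepWeight p′) ⟩
      stepWeight p′ 0 * pathWeight p ≈⟨ *-congʳ (reflexive (stepWeight-north p′ 0 (begins p))) ⟩
      1# * pathWeight p              ≈⟨ *-identityˡ _ ⟩
      pathWeight p                   ∎
      where
      p′ : Path s
      p′ = cons (inj₁ ≡.refl) p

    pathWeight-side : ∀ {s s′} (eq : side s ≡ just s′) (p : Path s′) →
                      pathWeight (cons (inj₂ eq) p) ≈ weight s s′ * pathWeight p
    pathWeight-side {s} eq p = begin
      pathWeight p′                  ≡⟨ big-upTo _*_ 1# (proj₁ (settles p)) (stepWeight p′) ⟩
      stepWeight p′ 0 * pathWeight p ≈⟨ *-congʳ (reflexive (≡.trans
                                          (stepWeight-side p′ 0 (≡.trans eq (≡.cong just (≡.sym (begins p)))))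
                                          (≡.cong (weight s) (begins p)))) ⟩
      weight s _ * pathWeight p      ∎
      where
      p′ : Path s
      p′ = cons (inj₂ eq) p

    ∑-sidePaths : ∀ {s} t (eq : side s ≡ t) {ps : ∀ s → List (Path s)} {g} →
                  (∀ s′ → ∑ (ps s′) pathWeight ≈ g s′) →
                  ∑ (sidePaths t eq ps) pathWeight ≈ onSide s t g
    ∑-sidePaths nothing eq ih = refl
    ∑-sidePaths {s} (just s′) eq {ps} {g} ih = begin
      ∑ (map (cons (inj₂ eq)) (ps s′)) pathWeight        ≡⟨ ∑-map (cons (inj₂ eq)) (ps s′) pathWeight ⟩
      ∑ (ps s′) (λ p → pathWeight (cons (inj₂ eq) p))    ≈⟨ ∑-cong (ps s′) (pathWeight-side eq) ⟩
      ∑ (ps s′) (λ p → weight s s′ * pathWeight p)       ≈⟨ *-distribˡ-∑ (weight s s′) (ps s′) pathWeight ⟨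
      weight s s′ * ∑ (ps s′) pathWeight                 ≈⟨ *-congˡ (ih s′) ⟩
      weight s s′ * g s′                                 ∎

    ∑-paths : ∀ m s → ∑ (paths m s) pathWeight ≈ count m s
    ∑-paths zero    s = ∑-straightPaths (columnOf s ℕₚ.≟ k)
    ∑-paths (suc m) s = begin
      ∑ (map (cons (inj₁ ≡.refl)) (paths m (north s)) ++ sidePaths (side s) ≡.refl (paths m)) pathWeight
        ≈⟨ ∑-++ (map (cons (inj₁ ≡.refl)) (paths m (north s))) _ pathWeight ⟩
      ∑ (map (cons (inj₁ ≡.refl)) (paths m (north s))) pathWeight + ∑ (sidePaths (side s) ≡.refl (paths m)) pathWeight
        ≈⟨ +-cong (begin
             ∑ (map (cons (inj₁ ≡.refl)) (paths m (north s))) pathWeight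
               ≡⟨ ∑-map (cons (inj₁ ≡.refl)) (paths m (north s)) pathWeight ⟩
             ∑ (paths m (north s)) (λ p → pathWeight (cons (inj₁ ≡.refl) p))
               ≈⟨ ∑-cong (paths m (north s)) pathWeight-north ⟩
             ∑ (paths m (north s)) pathWeight
               ≈⟨ ∑-paths m (north s) ⟩
             count m (north s) ∎)
           (∑-sidePaths (side s) ≡.refl (∑-paths m)) ⟩
      count m (north s) + onSide s (side s) (count m) ∎

    onSide-cong : ∀ {s} t → side s ≡ t → {g g′ : State → Carrier} →
                  (∀ {s′} → side s ≡ just s′ → weight s s′ * g s′ ≈ weight s s′ * g′ s′) →
                  onSide s t g ≈ onSide s t g′
    onSide-cong nothing   eq h = refl
    onSide-cong (just s′) eq h = h eq

    onSide-zero : ∀ {s} t → side s ≡ t → {g : State → Carrier} →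
                  (∀ {s′} → side s ≡ just s′ → weight s s′ * g s′ ≈ 0#) → onSide s t g ≈ 0#
    onSide-zero nothing   eq h = refl
    onSide-zero (just s′) eq h = h eq

    -- `P` is an invariant of the moves that keeps a path off column `k`; it will say that the
    -- column is already on the wrong side of `k`.
    count-vanish : (P : State → Set) → (∀ {s} → P s → P (north s)) →
                   (∀ {s s′} → P s → side s ≡ just s′ → P s′) → (∀ {s} → P s → columnOf s ≢ k) →
                   ∀ m {s} → P s → count m s ≈ 0#
    count-vanish P P-north P-side P-k zero    Ps = reflexive (δ-≢ (P-k Ps))
    count-vanish P P-north P-side P-k (suc m) {s} Ps = begin
      count m (north s) + onSide s (side s) (count m)
        ≈⟨ +-cong (count-vanish P P-north P-side P-k m (P-north Ps))
             (onSide-zero (side s) ≡.refl (λ eq → trans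
               (*-congˡ (count-vanish P P-north P-side P-k m (P-side Ps eq))) (zeroʳ _))) ⟩
      0# + 0#
        ≈⟨ +-identityˡ 0# ⟩
      0# ∎

    module Stability (growth : Growth 𝒜) (C : ℕ)
      (high : ∀ s s′ → Growth.Ok growth s → C ≤ Growth.Φ growth s →
              side s ≡ just s′ → weight s s′ ≈ 0#) where
      open Growth growth

      count-top : ∀ m {s} → Ok s → C ≤ Φ s → count m s ≈ δ (columnOf s) k
      count-top zero    ok C≤Φ = refl
      count-top (suc m) {s} ok C≤Φ = begin
        count m (north s) + onSide s (side s) (count m)
          ≈⟨ +-cong (count-top m (ok-north ok) (ℕₚ.≤-trans C≤Φ (ℕₚ.<⇒≤ (Φ-north ok))))
               (onSide-zero (side s) ≡.refl (λ eq → trans (*-congʳ (high s _ ok C≤Φ eq)) (zeroˡ _))) ⟩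
        δ (columnOf (north s)) k + 0#
          ≈⟨ +-identityʳ _ ⟩
        δ (columnOf (north s)) k
          ≡⟨ ≡.cong (λ i → δ i k) (north-column s) ⟩
        δ (columnOf s) k ∎

      -- The bound `C ≤ m + Φ s` survives every move: one step is spent and `Φ` gains at least one.
      -- Once the steps are used up, `Φ s` has reached `C` and the extra east step has weight zero.
      count-suc : ∀ m {s} → Ok s → C ≤ m ℕ.+ Φ s → count (suc m) s ≈ count m s
      count-suc zero    ok C≤Φ = count-top 1 ok C≤Φ
      count-suc (suc m) {s} ok C≤ = +-cong
        (count-suc m (ok-north ok) (raise (Φ-north ok)))
        (onSide-cong (side s) ≡.refl (λ eq → *-congˡ (count-suc m (ok-side ok eq) (raise (Φ-side ok eq)))))
        where
        raise : ∀ {φ} → Φ s < φ → C ≤ m ℕ.+ φ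
        raise {φ} Φ<φ = ℕₚ.≤-trans C≤
          (ℕₚ.≤-trans (ℕₚ.≤-reflexive (≡.sym (ℕₚ.+-suc m (Φ s)))) (ℕₚ.+-monoʳ-≤ m Φ<φ))

      count-stable : ∀ {m s} → Ok s → C ≤ m → count m s ≈ count C s
      count-stable {m} {s} ok C≤m = begin
        count m s                ≡⟨ ≡.cong (λ n → count n s) (ℕₚ.m∸n+n≡m C≤m) ⟨
        count (m ℕ.∸ C ℕ.+ C) s  ≈⟨ climb (m ℕ.∸ C) ⟩
        count C s                ∎
        where
        climb : ∀ d → count (d ℕ.+ C) s ≈ count C s
        climb zero    = refl
        climb (suc d) = trans
          (count-suc (d ℕ.+ C) ok (ℕₚ.≤-trans (ℕₚ.m≤n+m C d) (ℕₚ.m≤m+n _ _))) (climb d)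

      seq-grows : ∀ {s} (p : Path s) → Ok s → ∀ m → Ok (seq p m) × m ≤ Φ (seq p m)
      seq-grows p ok zero = ≡.subst Ok (≡.sym (begins p)) ok , z≤n
      seq-grows p ok (suc m) with seq-grows p ok m | moves p m
      ... | okₘ , m≤Φ | inj₁ eq = ≡.subst (λ s → Ok s × suc m ≤ Φ s) (≡.sym eq)
        (ok-north okₘ , ℕₚ.≤-<-trans m≤Φ (Φ-north okₘ))
      ... | okₘ , m≤Φ | inj₂ eq = ok-side okₘ eq , ℕₚ.≤-<-trans m≤Φ (Φ-side okₘ eq)

      -- After `i` moves `Φ` is at least `i`, so an east step at time `i ≥ C` puts a zero factor
      -- into the product.
      pathWeight-late : ∀ {s} (p : Path s) → Ok s → ∀ {i} → C ≤ i → SideStep p i → pathWeight p ≈ 0#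
      pathWeight-late p ok {i} C≤i e with seq-grows p ok i
      ... | okᵢ , i≤Φ = pathWeight-zero p e (high _ _ okᵢ (ℕₚ.≤-trans C≤i i≤Φ) e)

-- Power series up to the coefficient of a monomial

module FiniteSupport {r ℓ i ℓᵢ} (R : CommutativeRing r ℓ) (I : Setoid i ℓᵢ)
                     (_≟ᵢ_ : Decidable (Setoid._≈_ I)) where
  open Setoid I using () renaming (Carrier to J; _≈_ to _≈ᵢ_; sym to symᵢ)
  open CommutativeRing R
  open FiniteSums R
  open SetoidMembership I using (_∈_; _∉_)
  open SetoidUnique I using (Unique)
  open import Relation.Binary.Reasoning.Setoid setoid

  module _ (f : J → Carrier) (f-cong : ∀ {x y} → x ≈ᵢ y → f x ≈ f y) where

    pick : J → J → Carrier
    pick x y with x ≟ᵢ y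
    ... | yes _ = f y
    ... | no  _ = 0#

    pick-sym : ∀ x y → pick x y ≈ pick y x
    pick-sym x y with x ≟ᵢ y | y ≟ᵢ x
    ... | yes x≈y | yes _   = f-cong (symᵢ x≈y)
    ... | yes x≈y | no  y≉x = contradiction (symᵢ x≈y) y≉x
    ... | no  x≉y | yes y≈x = contradiction (symᵢ y≈x) x≉y
    ... | no  _   | no  _   = refl

    ∑-pick-∉ : ∀ x ys → x ∉ ys → ∑ ys (pick x) ≈ 0#
    ∑-pick-∉ x []       x∉ = refl
    ∑-pick-∉ x (y ∷ ys) x∉ with x ≟ᵢ y
    ... | yes x≈y = contradiction (here x≈y) x∉
    ... | no  _   = trans (+-identityˡ _) (∑-pick-∉ x ys (x∉ ∘ there))

    ∑-pick : ∀ x ys → Unique ys → (x ∉ ys → f x ≈ 0#) → ∑ ys (pick x) ≈ f x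
    ∑-pick x []       []! cover = sym (cover λ ())
    ∑-pick x (y ∷ ys) (y∉ AllPairs.∷ ys!) cover with x ≟ᵢ y
    ... | yes x≈y = begin
      f y + ∑ ys (pick x) ≈⟨ +-cong (f-cong (symᵢ x≈y)) (∑-pick-∉ x ys
                               (λ x∈ → Membershipₚ.All[≉]⇒∉ I y∉ (Membershipₚ.∈-resp-≈ I x≈y x∈))) ⟩
      f x + 0#            ≈⟨ +-identityʳ _ ⟩
      f x                 ∎
    ... | no x≉y = trans (+-identityˡ _) (∑-pick x ys ys!
      (λ x∉ → cover (λ { (here x≈y) → x≉y x≈y ; (there x∈) → x∉ x∈ })))

    -- Double counting of `pick` over `xs` and `ys`: an index has at most one partner in the other
    -- list, and if it has none then `f` vanishes there by the covering property.
    ∑-covers-agree : ∀ xs ys → Unique xs → Unique ys →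
                     (∀ z → z ∉ xs → f z ≈ 0#) → (∀ z → z ∉ ys → f z ≈ 0#) → ∑ xs f ≈ ∑ ys f
    ∑-covers-agree xs ys xs! ys! coverₓ coverᵧ = begin
      ∑ xs f                          ≈⟨ ∑-cong xs (λ x → ∑-pick x ys ys! (coverᵧ x)) ⟨
      ∑ xs (λ x → ∑ ys (pick x))      ≈⟨ ∑-swap xs ys pick ⟩
      ∑ ys (λ y → ∑ xs (λ x → pick x y)) ≈⟨ ∑-cong ys (λ y → ∑-cong xs (λ x → pick-sym x y)) ⟩
      ∑ ys (λ y → ∑ xs (pick y))      ≈⟨ ∑-cong ys (λ y → ∑-pick y xs xs! (coverₓ y)) ⟩
      ∑ ys f                          ∎

module SeriesProperties {a ℓ x} (A : CommutativeRing a ℓ) {X : Set x} (_≟_ : DecidableEquality X)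
  (isCR : RingLaws (PowerSeries.seriesRing A _≟_) (PowerSeries._≈ₛ_ A _≟_)) where

  open PowerSeries A _≟_
  open RawRing seriesRing using (_+_; _*_; -_; 0#; 1#)

  private
    module A = CommutativeRing A
    module S = IsCommutativeRing isCR
    ring : Ring (a Level.⊔ ℓ Level.⊔ x) (ℓ Level.⊔ x)
    ring = record { isRing = S.isRing }
  open FiniteSums A using (∑<-cong; ∑<-zero)
  open import Relation.Binary.Reasoning.Setoid A.setoid

  -- The largest ideal congruence that respects the coefficient of μ.
  infix 4 _∼[_]_
  record _∼[_]_ (f : Series) (μ : Monomial) (g : Series) : Set (a Level.⊔ ℓ Level.⊔ x) where
    constructor congruent
    field multiples : ∀ h → coeff (f * h) μ A.≈ coeff (g * h) μ

  open _∼[_]_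

  ≈⇒∼ : ∀ {μ f g} → f ≈ₛ g → f ∼[ μ ] g
  ≈⇒∼ {μ} {f} {g} eq = congruent λ h → S.*-congʳ {h} {f} {g} eq μ

  ∼⇒coeff : ∀ {μ f g} → f ∼[ μ ] g → coeff f μ A.≈ coeff g μ
  ∼⇒coeff {μ} {f} {g} eq =
    A.trans (A.sym (S.*-identityʳ f μ)) (A.trans (multiples eq 1#) (S.*-identityʳ g μ))

  ∑-∈-cong : ∀ {i} {I : Set i} (is : List I) {f g : I → A.Carrier} →
             (∀ {i} → i ∈ₗ is → f i A.≈ g i) → ∑ is f A.≈ ∑ is g
  ∑-∈-cong []       eq = A.refl
  ∑-∈-cong (i ∷ is) eq = A.+-cong (eq (here ≡.refl)) (∑-∈-cong is (eq ∘ there))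

  -- In the convolution at `μ` the first factor is seen only at the left components of the
  -- factorizations of `μ`.
  coeffs⇒∼ : ∀ {μ f g} → (∀ {α β} → (α , β) ∈ₗ factorizations μ → coeff f α A.≈ coeff g α) →
             f ∼[ μ ] g
  coeffs⇒∼ {μ} eq = congruent λ h → ∑-∈-cong (factorizations μ) (λ αβ∈ → A.*-congʳ (eq αβ∈))

  ∼-isCommutativeRing : ∀ μ → RingLaws seriesRing _∼[ μ ]_
  ∼-isCommutativeRing μ = record
    { isRing = record
      { +-isAbelianGroup = record
        { isGroup = record
          { isMonoid = record
            { isSemigroup = record
              { isMagma = record
                { isEquivalence = record
                  { refl  = congruent λ h → A.refl
                  ; sym   = λ eq → congruent λ h → A.sym (multiples eq h)
                  ; trans = λ eq eq′ → congruent λ h → A.trans (multiples eq h) (multiples eq′ h) }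
                ; ∙-cong = +-cong }
              ; assoc = λ f g h → ≈⇒∼ (S.+-assoc f g h) }
            ; identity = (λ f → ≈⇒∼ (S.+-identityˡ f)) , (λ f → ≈⇒∼ (S.+-identityʳ f)) }
          ; inverse = (λ f → ≈⇒∼ (S.-‿inverseˡ f)) , (λ f → ≈⇒∼ (S.-‿inverseʳ f))
          ; ⁻¹-cong = -‿cong }
        ; comm = λ f g → ≈⇒∼ (S.+-comm f g) }
      ; *-cong = *-cong
      ; *-assoc = λ f g h → ≈⇒∼ (S.*-assoc f g h)
      ; *-identity = (λ f → ≈⇒∼ (S.*-identityˡ f)) , (λ f → ≈⇒∼ (S.*-identityʳ f))
      ; distrib = (λ f g h → ≈⇒∼ (S.distribˡ f g h)) , (λ f g h → ≈⇒∼ (S.distribʳ f g h)) }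
    ; *-comm = λ f g → ≈⇒∼ (S.*-comm f g) }
    where
    open RingProperties ring using (-‿distribˡ-*)

    +-cong : ∀ {f f′ g g′} → f ∼[ μ ] f′ → g ∼[ μ ] g′ → f + g ∼[ μ ] f′ + g′
    +-cong {f} {f′} {g} {g′} eq eq′ = congruent λ h → begin
      coeff ((f + g) * h) μ                   ≈⟨ S.distribʳ h f g μ ⟩
      coeff (f * h) μ A.+ coeff (g * h) μ     ≈⟨ A.+-cong (multiples eq h) (multiples eq′ h) ⟩
      coeff (f′ * h) μ A.+ coeff (g′ * h) μ   ≈⟨ S.distribʳ h f′ g′ μ ⟨
      coeff ((f′ + g′) * h) μ                 ∎

    -‿cong : ∀ {f g} → f ∼[ μ ] g → - f ∼[ μ ] - g
    -‿cong {f} {g} eq = congruent λ h → begin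
      coeff (- f * h) μ     ≈⟨ -‿distribˡ-* f h μ ⟨
      A.- coeff (f * h) μ   ≈⟨ A.-‿cong (multiples eq h) ⟩
      A.- coeff (g * h) μ   ≈⟨ -‿distribˡ-* g h μ ⟩
      coeff (- g * h) μ     ∎

    -- The arbitrary multiplier absorbs the other factor: `f` is replaced in `f * (g * h)`, then `g`
    -- is brought to the front and replaced in `g * (h * f′)`.
    *-cong : ∀ {f f′ g g′} → f ∼[ μ ] f′ → g ∼[ μ ] g′ → f * g ∼[ μ ] f′ * g′
    *-cong {f} {f′} {g} {g′} eq eq′ = congruent λ h → begin
      coeff (f * g * h) μ      ≈⟨ S.*-assoc f g h μ ⟩
      coeff (f * (g * h)) μ    ≈⟨ multiples eq (g * h) ⟩
      coeff (f′ * (g * h)) μ   ≈⟨ A.trans (S.*-comm f′ (g * h) μ) (S.*-assoc g h f′ μ) ⟩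
      coeff (g * (h * f′)) μ   ≈⟨ multiples eq′ (h * f′) ⟩
      coeff (g′ * (h * f′)) μ  ≈⟨ A.trans (S.*-comm f′ (g′ * h) μ) (S.*-assoc g′ h f′ μ) ⟨
      coeff (f′ * (g′ * h)) μ  ≈⟨ S.*-assoc f′ g′ h μ ⟨
      coeff (f′ * g′ * h) μ    ∎

  coeff-0# : ∀ μ → coeff 0# μ A.≈ A.0#
  coeff-0# []      = A.refl
  coeff-0# (_ ∷ _) = A.refl

  coeff-big : ∀ {i} {I : Set i} (is : List I) (f : I → Series) μ →
              coeff (big _+_ 0# is f) μ A.≈ ∑ is (λ i → coeff (f i) μ)
  coeff-big []       f μ = coeff-0# μ
  coeff-big (i ∷ is) f μ = A.+-congˡ (coeff-big is f μ)

  HasSum-unique : ∀ {i ℓᵢ} (I : Setoid i ℓᵢ) → Decidable (Setoid._≈_ I) →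
                  ∀ {f} → (∀ {i j} → Setoid._≈_ I i j → f i ≈ₛ f j) →
                  ∀ {s t} → HasSum I f s → HasSum I f t → s ≈ₛ t
  HasSum-unique I _≟ᵢ_ {f} f-cong sumₛ sumₜ μ with sumₛ μ | sumₜ μ
  ... | is , is! , cover , s≈ | is′ , is′! , cover′ , t≈ = A.trans s≈ (A.trans
    (FiniteSupport.∑-covers-agree A I _≟ᵢ_ (λ i → coeff (f i) μ) (λ eq → f-cong eq μ)
      is is′ is! is′! cover cover′)
    (A.sym t≈))

  HasSum-transport : ∀ {i ℓᵢ j ℓⱼ} {I : Setoid i ℓᵢ} {J : Setoid j ℓⱼ} (I↔J : Inverse I J) {f g s} →
                     (∀ i → g (Inverse.to I↔J i) ≈ₛ f i) → (∀ j → f (Inverse.from I↔J j) ≈ₛ g j) →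
                     HasSum I f s → HasSum J g s
  HasSum-transport {I = I} {J} I↔J {f} {g} {s} g∘to f∘from sum μ with sum μ
  ... | is , is! , cover , s≈ = map to is
    , Uniqueₚ.map⁺ I J (λ eq → I.trans (I.sym (strictlyInverseʳ _)) (I.trans (from-cong eq) (strictlyInverseʳ _))) is!
    , (λ j j∉ → A.trans (A.sym (f∘from j μ)) (cover (from j) (λ from∈ → j∉
        (Membershipₚ.∈-resp-≈ J (strictlyInverseˡ j) (Membershipₚ.∈-map⁺ I J {f = to} to-cong from∈)))))
    , (begin
        coeff s μ                              ≈⟨ s≈ ⟩
        ∑ is (λ i → coeff (f i) μ)             ≈⟨ ∑-cong is (λ i → g∘to i μ) ⟨
        ∑ is (λ i → coeff (g (to i)) μ)        ≡⟨ ∑-map to is (λ j → coeff (g j) μ) ⟨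
        ∑ (map to is) (λ j → coeff (g j) μ)    ∎)
    where
    open Inverse I↔J
    module I = Setoid I

  module PathSums (𝒜 : Automaton) (k : ℕ) (weight : Automaton.State 𝒜 → Automaton.State 𝒜 → Series) where
    open Automaton 𝒜
    open Paths 𝒜 k
    open Counting 𝒜 k seriesRing weight

    pathSum-unique : ∀ {s f g} → HasSum (pathSetoid s) pathWeight f → HasSum (pathSetoid s) pathWeight g → f ≈ₛ g
    pathSum-unique {s} {f} {g} = HasSum-unique (pathSetoid s) _≟ₚ_ {pathWeight}
      (λ {p} {p′} → Counting.Laws.pathWeight-cong 𝒜 k seriesRing weight {_≋_ = _≈ₛ_} isCR {p = p} {p′}) {f} {g}

    -- Only the first C steps matter for the coefficient of μ.
    record Truncated (μ : Monomial) (s : State) (C : ℕ) : Set (a Level.⊔ ℓ Level.⊔ x) where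
      field
        stable : ∀ {m} → C ≤ m → count m s ∼[ μ ] count C s
        late   : ∀ (p : Path s) {i} → C ≤ i → SideStep p i → pathWeight p ∼[ μ ] 0#

    open Truncated

    stable-≤ : ∀ {μ s C m m′} → Truncated μ s C → C ≤ m → C ≤ m′ → coeff (count m s) μ A.≈ coeff (count m′ s) μ
    stable-≤ t C≤m C≤m′ = A.trans (∼⇒coeff (stable t C≤m)) (A.sym (∼⇒coeff (stable t C≤m′)))

    module Total (s : State) (truncated : ∀ μ → ∃ (Truncated μ s)) where

      private
        cutoff : Monomial → ℕ
        cutoff μ = proj₁ (truncated μ)

      -- The cutoff supplied by `truncated` is only one of many, and may even differ between two
      -- lists that represent the same monomial. Any two valid cutoffs are compared at a common
      -- later one.
      total-coeff : ∀ μ {C m} → Truncated μ s C → C ≤ m →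
                    coeff (count (cutoff μ) s) μ A.≈ coeff (count m s) μ
      total-coeff μ {C} {m} t C≤m = A.trans
        (stable-≤ (proj₂ (truncated μ)) ℕₚ.≤-refl (ℕₚ.m≤m⊔n (cutoff μ) m))
        (stable-≤ t (ℕₚ.≤-trans C≤m (ℕₚ.m≤n⊔m (cutoff μ) m)) C≤m)

      total : Series
      total .coeff μ = coeff (count (cutoff μ) s) μ
      total .coeff-cong {μ} {μ′} eq = begin
        coeff (count (cutoff μ) s) μ     ≈⟨ total-coeff μ (proj₂ (truncated μ)) (ℕₚ.m≤m⊔n (cutoff μ) (cutoff μ′)) ⟩
        coeff (count m s) μ              ≈⟨ coeff-cong (count m s) {μ} {μ′} eq ⟩
        coeff (count m s) μ′             ≈⟨ total-coeff μ′ (proj₂ (truncated μ′)) (ℕₚ.m≤n⊔m (cutoff μ) (cutoff μ′)) ⟨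
        coeff (count (cutoff μ′) s) μ′   ∎
        where m = cutoff μ ⊔ cutoff μ′

      -- The coefficients of `total` come from different cutoffs; a `C` valid for every left factor
      -- of `μ` lets a single count replace it modulo `μ`.
      total-∼ : ∀ {μ C m} → (∀ {α β} → (α , β) ∈ₗ factorizations μ → Truncated α s C) → C ≤ m →
                total ∼[ μ ] count m s
      total-∼ {μ} t C≤m = coeffs⇒∼ (λ {α} αβ∈ → total-coeff α (t αβ∈) C≤m)

      total-HasSum : HasSum (pathSetoid s) pathWeight total
      total-HasSum μ = paths C s , paths-unique C s , cover , (begin
        coeff (count C s) μ                             ≈⟨ Counting.Laws.∑-paths 𝒜 k seriesRing weight isCR C s μ ⟨
        coeff (big _+_ 0# (paths C s) pathWeight) μ     ≈⟨ coeff-big (paths C s) pathWeight μ ⟩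
        ∑ (paths C s) (λ p → coeff (pathWeight p) μ)    ∎)
        where
        C = cutoff μ
        cover : ∀ p → ¬ (p ∈ paths C s) → coeff (pathWeight p) μ A.≈ A.0#
        cover p p∉ with paths-complete C p
        ... | inj₁ p∈             = contradiction p∈ p∉
        ... | inj₂ (i , C≤i , e)  = A.trans
          (∼⇒coeff (late (proj₂ (truncated μ)) p C≤i e)) (coeff-0# μ)

-- The lecture hall graph

northFrom : ∀ t {i} {j : Fin (suc i)} → View j → Vertex
northFrom t {i} ‵fromℕ             = v (suc t) i zero
northFrom t {i} (‵inj₁ {i = j} _)  = v t i (suc j)

north : Vertex → Vertex
north (v t i j) = northFrom t (view j)

-- A vertex with `j = i` is the first on its line of east steps, so nothing lies to its west.
westFrom : ∀ t {i} {j : Fin (suc i)} → View j → Maybe Vertex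
westFrom t         ‵fromℕ            = nothing
westFrom t {suc i} (‵inj₁ {i = j} _) = just (v t i j)

west : Vertex → Maybe Vertex
west (v t i j) = westFrom t (view j)

east⁺ : Vertex → Vertex
east⁺ (v t i j) = v t (suc i) (inject₁ j)

North⇒north : ∀ {u u′} → North u u′ → u′ ≡ north u
North⇒north (inner {t} j)  = ≡.cong (northFrom t) (≡.sym (view-inject₁ j))
North⇒north (wrap {t} {i}) = ≡.cong (northFrom t) (≡.sym (view-fromℕ i))

north-North : ∀ u → North u (north u)
north-North (v t i j) with view j
... | ‵fromℕ           = wrap
... | ‵inj₁ {i = j} _  = inner j

north⇒North : ∀ {u u′} → u′ ≡ north u → North u u′
north⇒North {u} ≡.refl = north-North u

East⇒east : ∀ {u u′} → East u u′ → u′ ≡ east⁺ u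
East⇒east (east j) = ≡.refl

east⇒East : ∀ {u u′} → u′ ≡ east⁺ u → East u u′
east⇒East {v t i j} ≡.refl = east j

west-east : ∀ u → west (east⁺ u) ≡ just u
west-east (v t i j) = ≡.cong (westFrom t) (view-inject₁ j)

East⇒west : ∀ {u u′} → East u u′ → west u′ ≡ just u
East⇒west {u} (east j) = west-east u

west⇒East : ∀ {u u′} → west u′ ≡ just u → East u u′
west⇒East {u′ = v t i j} eq with view j
west⇒East {u′ = v t (suc i) _} ≡.refl | ‵inj₁ {i = j} _ = east j

column-north : ∀ u → column (north u) ≡ column u
column-north (v t i j) with view j
... | ‵fromℕ  = ≡.refl
... | ‵inj₁ _ = ≡.refl

column-East : ∀ {u u′} → East u u′ → column u′ ≡ suc (column u)
column-East (east j) = ≡.refl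

North-East-disjoint : ∀ {u u′} → u′ ≡ north u → ¬ East u u′
North-East-disjoint {u} eq e = ℕₚ.1+n≢n
  (≡.trans (≡.sym (column-East e)) (≡.trans (≡.cong column eq) (column-north u)))

_≟ᵥ_ : DecidableEquality Vertex
v t i j ≟ᵥ v t′ i′ j′ with t ℕₚ.≟ t′ | i ℕₚ.≟ i′
... | no t≢t′    | _          = no λ { ≡.refl → t≢t′ ≡.refl }
... | yes _      | no i≢i′    = no λ { ≡.refl → i≢i′ ≡.refl }
... | yes ≡.refl | yes ≡.refl with j Finₚ.≟ j′
...   | yes ≡.refl = yes ≡.refl
...   | no  j≢j′   = no λ { ≡.refl → j≢j′ ≡.refl }

-- The lexicographic position of the line (t , j) as a number. The radix `suc N` exceeds every index
-- in the columns up to `N`, so even the wrap to the next level is an increase.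
height : ℕ → Vertex → ℕ
height N u = level u ℕ.* suc N ℕ.+ toℕ (index u)

height-north : ∀ {N} u → column u ≤ N → height N u < height N (north u)
height-north {N} (v t i j) i≤N with view j
... | ‵fromℕ = begin-strict
  t ℕ.* suc N ℕ.+ toℕ (fromℕ i)   ≡⟨ ≡.cong (t ℕ.* suc N ℕ.+_) (Finₚ.toℕ-fromℕ i) ⟩
  t ℕ.* suc N ℕ.+ i               ≤⟨ ℕₚ.+-monoʳ-≤ (t ℕ.* suc N) i≤N ⟩
  t ℕ.* suc N ℕ.+ N               <⟨ ℕₚ.+-monoʳ-< (t ℕ.* suc N) (ℕₚ.n<1+n N) ⟩
  t ℕ.* suc N ℕ.+ suc N           ≡⟨ ℕₚ.+-comm (t ℕ.* suc N) (suc N) ⟩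
  suc t ℕ.* suc N                 ≡⟨ ℕₚ.+-identityʳ _ ⟨
  suc t ℕ.* suc N ℕ.+ 0           ∎
  where open ℕₚ.≤-Reasoning
... | ‵inj₁ {i = j} _ = ℕₚ.+-monoʳ-< (t ℕ.* suc N) (s≤s (ℕₚ.≤-reflexive (Finₚ.toℕ-inject₁ j)))

height-East : ∀ N {u u′} → East u u′ → height N u ≡ height N u′
height-East N (east {t} j) = ≡.cong (t ℕ.* suc N ℕ.+_) (≡.sym (Finₚ.toℕ-inject₁ j))

-- The index and the slack `c`, which is the column term of a potential, are each at most `N`. On a
-- level `t < T` the sum thus stays below `(t + 2) * suc N`, hence below `suc T * suc N`.
level-bound : ∀ {N T c} u → column u ≤ N → c ≤ N →
              suc T ℕ.* suc N ≤ height N u ℕ.+ c → T ≤ level u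
level-bound {N} {T} {c} (v t i j) i≤N c≤N le with T ℕₚ.≤? t
... | yes T≤t = T≤t
... | no  T≰t = contradiction le (ℕₚ.<⇒≱ (begin-strict
  t ℕ.* suc N ℕ.+ toℕ j ℕ.+ c     ≤⟨ ℕₚ.+-mono-≤ (ℕₚ.+-monoʳ-≤ (t ℕ.* suc N)
                                       (ℕₚ.≤-trans (Finₚ.toℕ≤pred[n] j) i≤N)) c≤N ⟩
  t ℕ.* suc N ℕ.+ N ℕ.+ N         <⟨ ℕₚ.+-mono-< (ℕₚ.+-monoʳ-< (t ℕ.* suc N) (ℕₚ.n<1+n N)) (ℕₚ.n<1+n N) ⟩
  t ℕ.* suc N ℕ.+ suc N ℕ.+ suc N ≡⟨ ≡.cong (ℕ._+ suc N) (ℕₚ.+-comm (t ℕ.* suc N) (suc N)) ⟩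
  suc t ℕ.* suc N ℕ.+ suc N       ≡⟨ ℕₚ.+-comm (suc t ℕ.* suc N) (suc N) ⟩
  suc (suc t) ℕ.* suc N           ≤⟨ ℕₚ.*-monoˡ-≤ (suc N) (s≤s (ℕₚ.≰⇒> T≰t)) ⟩
  suc T ℕ.* suc N                 ∎))
  where open ℕₚ.≤-Reasoning

climbing-limit : ∀ {at : ℕ → Vertex} {k} M → (∀ m → M ≤ m → column (at m) ≡ k) →
                 (∀ m → M ≤ m → at (suc m) ≡ north (at m)) → TendsTo∞ at k
-- After `M` each move raises `height k` by at least one; `suc B * suc k` further moves reach level
-- `B` by `level-bound` with `c = 0`.
climbing-limit {at} {k} M col up B = suc B ℕ.* suc k ℕ.+ M , λ m le →
  let M≤m = ℕₚ.≤-trans (ℕₚ.m≤n+m M (suc B ℕ.* suc k)) le in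
  col m M≤m , level-bound (at m) (ℕₚ.≤-reflexive (col m M≤m)) z≤n (begin
    suc B ℕ.* suc k                      ≡⟨ ℕₚ.m+n∸n≡m (suc B ℕ.* suc k) M ⟨
    suc B ℕ.* suc k ℕ.+ M ℕ.∸ M          ≤⟨ ℕₚ.∸-monoˡ-≤ M le ⟩
    m ℕ.∸ M                              ≤⟨ climb (m ℕ.∸ M) ⟩
    height k (at (m ℕ.∸ M ℕ.+ M))        ≡⟨ ≡.cong (height k ∘ at) (ℕₚ.m∸n+n≡m M≤m) ⟩
    height k (at m)                      ≡⟨ ℕₚ.+-identityʳ _ ⟨
    height k (at m) ℕ.+ 0                ∎)
  where
  open ℕₚ.≤-Reasoning
  climb : ∀ d → d ≤ height k (at (d ℕ.+ M))
  climb zero    = z≤n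
  climb (suc d) = ℕₚ.≤-<-trans (climb d) (≡.subst (λ u → height k (at (d ℕ.+ M)) < height k u)
    (≡.sym (up (d ℕ.+ M) (ℕₚ.m≤n+m M d)))
    (height-north (at (d ℕ.+ M)) (ℕₚ.≤-reflexive (col (d ℕ.+ M) (ℕₚ.m≤n+m M d)))))

-- The vertices v^t_{i,j}, i ≥ j, with t and j fixed form a line of east steps;
-- in the columns i < j, where the line has no vertex, the next vertex above it
-- takes its place.
line : ℕ → ℕ → ℕ → Vertex
line t j i with j ℕₚ.≤? i
... | yes j≤i = v t i (fromℕ< (s≤s j≤i))
... | no  _   = v (suc t) i zero

line-above : ∀ {t j i} → i < j → line t j i ≡ v (suc t) i zero
line-above {t} {j} {i} i<j with j ℕₚ.≤? i
... | yes j≤i = contradiction j≤i (ℕₚ.<⇒≱ i<j)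
... | no  _   = ≡.refl

line-toℕ : ∀ t {i} (j : Fin (suc i)) → line t (toℕ j) i ≡ v t i j
line-toℕ t {i} j with toℕ j ℕₚ.≤? i
... | yes j≤i = ≡.cong (v t i) (Finₚ.fromℕ<-toℕ j (s≤s j≤i))
... | no  j≰i = contradiction (Finₚ.toℕ≤pred[n] j) j≰i

column-line : ∀ t j i → column (line t j i) ≡ i
column-line t j i with j ℕₚ.≤? i
... | yes _ = ≡.refl
... | no  _ = ≡.refl

asFin : ∀ {j i} → j ≤ i → ∃ λ (f : Fin (suc i)) → toℕ f ≡ j
asFin j≤i = fromℕ< (s≤s j≤i) , Finₚ.toℕ-fromℕ< (s≤s j≤i)

-- This also covers `j = i`: the step then wraps to `v (suc t) i zero`, which is exactly the
-- substitute vertex of the line `suc i` in column `i`.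
north-line : ∀ {t j i} → j ≤ i → north (line t j i) ≡ line t (suc j) i
north-line {t} {i = i} j≤i with asFin j≤i
... | f , ≡.refl = ≡.trans (≡.cong north (line-toℕ t f)) (above (view f))
  where
  above : ∀ {f : Fin (suc i)} (w : View f) → northFrom t w ≡ line t (suc (toℕ f)) i
  above ‵fromℕ            = ≡.sym (line-above (s≤s (ℕₚ.≤-reflexive (≡.sym (Finₚ.toℕ-fromℕ i)))))
  above (‵inj₁ {i = j} _) = ≡.trans (≡.sym (line-toℕ t (suc j)))
    (≡.cong (λ j → line t (suc j) i) (≡.sym (Finₚ.toℕ-inject₁ j)))

east-line : ∀ {t j i} → j ≤ i → east⁺ (line t j i) ≡ line t j (suc i)
east-line {t} {i = i} j≤i with asFin j≤i
... | f , ≡.refl = ≡.trans (≡.cong east⁺ (line-toℕ t f)) (≡.trans (≡.sym (line-toℕ t (inject₁ f)))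
  (≡.cong (λ j → line t j (suc i)) (Finₚ.toℕ-inject₁ f)))

west-line : ∀ {t j i} → j ≤ i → west (line t j (suc i)) ≡ just (line t j i)
west-line {t} {j} {i} j≤i = ≡.trans (≡.cong west (≡.sym (east-line j≤i))) (west-east (line t j i))

west-line-first : ∀ {t} i → west (line t i i) ≡ nothing
west-line-first {t} i = ≡.trans (≡.cong west (≡.trans (≡.cong (λ j → line t j i) (≡.sym (Finₚ.toℕ-fromℕ i)))
  (line-toℕ t (fromℕ i)))) (≡.cong (westFrom t) (view-fromℕ i))

-- The automata of SE and NE* paths

southEast : Automaton
southEast = record
  { State = Vertex ; _≟ₛ_ = _≟ᵥ_ ; columnOf = column ; north = north ; side = west
  ; north-column = column-north
  ; side-column  = λ {u} eq col≡ → ℕₚ.1+n≢n (≡.trans (≡.sym (column-East (west⇒East {u′ = u} eq))) (≡.sym col≡)) }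

-- East steps leave the height unchanged, so `Φ` also needs a term that grows along them. Read
-- backwards they lower the column, which suggests `N ∸ column u`; for NE* paths the column itself
-- serves.
southEast-growth : ℕ → Growth southEast
southEast-growth N = record
  { Ok       = λ u → column u ≤ N
  ; ok-north = λ {u} → ≡.subst (_≤ N) (≡.sym (column-north u))
  ; ok-side  = λ {u} ok eq → ℕₚ.≤-trans (ℕₚ.n≤1+n _) (≡.subst (_≤ N) (column-East (west⇒East {u′ = u} eq)) ok)
  ; Φ        = λ u → height N u ℕ.+ (N ℕ.∸ column u)
  ; Φ-north  = λ {u} ok → ℕₚ.+-mono-<-≤ (height-north u ok)
                 (ℕₚ.≤-reflexive (≡.cong (N ℕ.∸_) (≡.sym (column-north u))))
  ; Φ-side   = λ {u} ok eq → ℕₚ.+-mono-≤-<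
                 (ℕₚ.≤-reflexive (≡.sym (height-East N (west⇒East {u′ = u} eq))))
                 (ℕₚ.∸-monoʳ-< (ℕₚ.≤-reflexive (≡.sym (column-East (west⇒East {u′ = u} eq)))) ok)
  }

-- The flag of a state tells whether it was entered by an east step.
eastFrom : ℕ → Vertex × Bool → Maybe (Vertex × Bool)
eastFrom k (u , true)  = nothing
eastFrom k (u , false) with column u ℕₚ.<? k
... | yes _ = just (east⁺ u , true)
... | no  _ = nothing

eastFrom-< : ∀ {k u} → column u < k → eastFrom k (u , false) ≡ just (east⁺ u , true)
eastFrom-< {k} {u} u<k with column u ℕₚ.<? k
... | yes _   = ≡.refl
... | no  u≮k = contradiction u<k u≮k

eastFrom-≥ : ∀ {k u} → k ≤ column u → eastFrom k (u , false) ≡ nothing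
eastFrom-≥ {k} {u} k≤u with column u ℕₚ.<? k
... | yes u<k = contradiction k≤u (ℕₚ.<⇒≱ u<k)
... | no  _   = ≡.refl

eastFrom-just : ∀ {k} s {s′} → eastFrom k s ≡ just s′ →
                proj₂ s ≡ false × s′ ≡ (east⁺ (proj₁ s) , true) × column (proj₁ s) < k
eastFrom-just {k} (u , false) eq with column u ℕₚ.<? k
eastFrom-just {k} (u , false) ≡.refl | yes u<k = ≡.refl , ≡.refl , u<k

-- Here `k` is the final column, and `eastFrom` blocks east steps out of column `k` and beyond.
-- Columns never decrease, so no path ending in column `k` is lost, and the columns stay bounded as
-- the potential requires.
northEast* : ℕ → Automaton
northEast* k = record
  { State = Vertex × Bool ; _≟ₛ_ = ×-≡-dec _≟ᵥ_ Boolₚ._≟_ ; columnOf = column ∘ proj₁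
  ; north = λ (u , _) → north u , false ; side = eastFrom k
  ; north-column = λ (u , _) → column-north u
  ; side-column  = λ {s} eq col≡ → ℕₚ.1+n≢n
      (≡.trans (≡.cong (column ∘ proj₁) (≡.sym (proj₁ (proj₂ (eastFrom-just s eq))))) col≡) }

northEast*-growth : ∀ {k N} → k ≤ N → Growth (northEast* k)
northEast*-growth {k} {N} k≤N = record
  { Ok       = λ (u , _) → column u ≤ N
  ; ok-north = λ {(u , _)} → ≡.subst (_≤ N) (≡.sym (column-north u))
  ; ok-side  = λ {s} ok eq → ≡.subst (λ s → column (proj₁ s) ≤ N)
                 (≡.sym (proj₁ (proj₂ (eastFrom-just s eq))))
                 (ℕₚ.≤-trans (proj₂ (proj₂ (eastFrom-just s eq))) k≤N)
  ; Φ        = λ (u , _) → height N u ℕ.+ column u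
  ; Φ-north  = λ {(u , _)} ok → ℕₚ.+-mono-<-≤ (height-north u ok) (ℕₚ.≤-reflexive (≡.sym (column-north u)))
  ; Φ-side   = λ {s} ok eq → ≡.subst
                 (λ s′ → height N (proj₁ s) ℕ.+ column (proj₁ s) < height N (proj₁ s′) ℕ.+ column (proj₁ s′))
                 (≡.sym (proj₁ (proj₂ (eastFrom-just s eq))))
                 (ℕₚ.+-mono-≤-< (ℕₚ.≤-reflexive (height-East N (east⇒East {proj₁ s} ≡.refl))) ℕₚ.≤-refl)
  }

-- Sweeping the lines of the lecture hall graph

-- The east step is traversed backwards, so its initial vertex is the state being entered.
westWeight : ∀ {c} {C : Set c} → (Vertex → C) → Vertex → Vertex → C
westWeight f u u′ = f u′

eastWeightFrom : ∀ {c} {C : Set c} → (Vertex → C) → Vertex × Bool → Vertex × Bool → C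
eastWeightFrom f (u , _) _ = f u

alternating : ∀ {c ℓ} (R : RawRing c ℓ) → ℕ → RawRing.Carrier R
alternating R zero    = RawRing.1# R
alternating R (suc d) = RawRing.-_ R (alternating R d)

module Sweep {c ℓ ℓ′} (S : RawRing c ℓ) {_≋_ : Rel (RawRing.Carrier S) ℓ′}
  (isCR : RingLaws S _≋_) (eastW : Vertex → RawRing.Carrier S) {N T C}
  (vanishes : ∀ u → T ≤ level u → column u ≤ N → eastW u ≋ RawRing.0# S) (large : suc T ℕ.* suc N ≤ C) where

  open RawRing S hiding (_≈_)

  ring : CommutativeRing c ℓ′
  ring = record { isCommutativeRing = isCR }

  open CommutativeRing ring hiding (_+_; _*_; -_; 0#; 1#; zero; ring; Carrier)
  open FiniteSums ring using (∑; ∑-by-parts; ∑-δʳ; ∑<-cong; δ)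
  open import Relation.Binary.Reasoning.Setoid setoid

  module SE (k : ℕ) where
    high : ∀ u u′ → column u ≤ N → C ≤ height N u ℕ.+ (N ℕ.∸ column u) → west u ≡ just u′ → eastW u′ ≈ 0#
    high u u′ u≤N C≤ eq with west⇒East {u′ = u} eq
    ... | east j = vanishes u′ (level-bound u u≤N (ℕₚ.m∸n≤m N (column u)) (ℕₚ.≤-trans large C≤))
      (ℕₚ.≤-trans (ℕₚ.n≤1+n _) u≤N)

    open Counting southEast k S (westWeight eastW) public
    open Laws isCR public
    open Stability (southEast-growth N) C high public

  module NE (k : ℕ) (k≤N : k ≤ N) where
    high : ∀ s s′ → column (proj₁ s) ≤ N → C ≤ height N (proj₁ s) ℕ.+ column (proj₁ s) →
           eastFrom k s ≡ just s′ → eastW (proj₁ s) ≈ 0#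
    high (u , _) _ u≤N C≤ eq = vanishes u (level-bound u u≤N u≤N (ℕₚ.≤-trans large C≤)) u≤N

    open Counting (northEast* k) k S (eastWeightFrom eastW) public
    open Laws isCR public
    open Stability (northEast*-growth k≤N) C high public

  seCount : ℕ → Vertex → Carrier
  seCount k = Counting.count southEast k S (westWeight eastW) C

  neCount : ℕ → Vertex × Bool → Carrier
  neCount k = Counting.count (northEast* k) k S (eastWeightFrom eastW) C

  sgn : ℕ → Carrier
  sgn = alternating S

  lineWeight : ∀ {j n} → ℕ → Dec (j ≤ n) → Carrier
  lineWeight {j} {n} t (yes _) = eastW (line t j n)
  lineWeight         t (no _)  = 0#

  -- The entry of X_L for the step between columns `n` and `suc n`; it is zero to the left of the
  -- first vertex of the line.
  crossing : ℕ → ℕ → ℕ → Carrier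
  crossing t j n = lineWeight t (j ℕₚ.≤? n)

  lineWeight-≤ : ∀ {t j n} (d : Dec (j ≤ n)) → j ≤ n → lineWeight t d ≡ eastW (line t j n)
  lineWeight-≤ (yes _)  j≤n = ≡.refl
  lineWeight-≤ (no j≰n) j≤n = contradiction j≤n j≰n

  lineWeight-> : ∀ {t j n} (d : Dec (j ≤ n)) → n < j → lineWeight t d ≡ 0#
  lineWeight-> (yes j≤n) n<j = contradiction j≤n (ℕₚ.<⇒≱ n<j)
  lineWeight-> (no _)    n<j = ≡.refl

  crossing-≤ : ∀ {t j n} → j ≤ n → crossing t j n ≡ eastW (line t j n)
  crossing-≤ {t} {j} {n} = lineWeight-≤ {t} (j ℕₚ.≤? n)

  crossing-> : ∀ {t j n} → n < j → crossing t j n ≡ 0#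
  crossing-> {t} {j} {n} = lineWeight-> {t} (j ℕₚ.≤? n)

  -- `H t j` and `E t j` are the truncated sums h and e over the lines from (t , j) upwards: all
  -- lines for (0 , 0), the identity matrix once the level is high. In `E t j k n` the final column
  -- comes first, as in e_{k,n}.
  H : ℕ → ℕ → ℕ → ℕ → Carrier
  H t j n k = seCount k (line t j n)

  E : ℕ → ℕ → ℕ → ℕ → Carrier
  E t j k n = neCount k (line t j n , false)

  column-line-≤ : ∀ {t j n} → n ≤ N → column (line t j n) ≤ N
  column-line-≤ {t} {j} {n} = ≡.subst (_≤ N) (≡.sym (column-line t j n))

  -- An extra step beyond `C` changes nothing, so the first move can be split off while the
  -- remaining counts keep the cutoff `C`.
  H-unfold : ∀ {k u u′ t} → column u ≤ N → north u ≡ u′ → west u ≡ t →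
             seCount k u ≈ seCount k u′ + Counting.onSide southEast k S (westWeight eastW) u t (seCount k)
  H-unfold {k} {u} u≤N ≡.refl ≡.refl = sym (SE.count-suc k C {u} u≤N (ℕₚ.m≤m+n C _))

  E-unfold : ∀ {k s s′ t} → k ≤ N → column (proj₁ s) ≤ N → (north (proj₁ s) , false) ≡ s′ → eastFrom k s ≡ t →
             neCount k s ≈ neCount k s′ + Counting.onSide (northEast* k) k S (eastWeightFrom eastW) s t (neCount k)
  E-unfold {k} {s} k≤N u≤N ≡.refl ≡.refl = sym (NE.count-suc k k≤N C {s} u≤N (ℕₚ.m≤m+n C _))

  H-zero : ∀ t j k → H t j 0 k ≈ H t (suc j) 0 k
  H-zero t zero k = trans
    (H-unfold {k} (column-line-≤ {t} {0} {0} z≤n) (north-line {t} {0} {0} z≤n) (west-line-first {t} 0))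
    (+-identityʳ _)
  H-zero t (suc j) k = refl

  line-unmoved : ∀ {t j n} → n < j → line t j n ≡ line t (suc j) n
  line-unmoved {t} n<j = ≡.trans (line-above {t} n<j) (≡.sym (line-above {t} (ℕₚ.m<n⇒m<1+n n<j)))

  -- After the east step the walk is still on the same line, so `H t j` itself recurs on the right:
  -- this is the recursion of (1 - X_L)⁻¹.
  H-suc : ∀ t j {n} k → suc n ≤ N →
          H t j (suc n) k ≈ H t (suc j) (suc n) k + crossing t j n * H t j n k
  H-suc t j {n} k n<N with ℕₚ.<-cmp j (suc n)
  ... | tri< j<1+n _ _ = trans
    (H-unfold {k} (column-line-≤ {t} {j} n<N) (north-line (ℕₚ.<⇒≤ j<1+n)) (west-line (ℕ.s≤s⁻¹ j<1+n)))
    (+-congˡ (*-congʳ (reflexive (≡.sym (crossing-≤ (ℕ.s≤s⁻¹ j<1+n))))))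
  ... | tri≈ _ ≡.refl _ = trans
    (H-unfold {k} (column-line-≤ {t} {j} n<N) (north-line {t} {j} ℕₚ.≤-refl) (west-line-first {t} j))
    (+-congˡ (sym (trans (*-congʳ (reflexive (crossing-> {t} {j} (ℕₚ.n<1+n n)))) (zeroˡ _))))
  ... | tri> _ _ 1+n<j = trans
    (reflexive (≡.cong (seCount k) (line-unmoved {t} 1+n<j)))
    (sym (trans (+-congˡ (trans (*-congʳ (reflexive (crossing-> {t} {j} (ℕₚ.<⇒≤ 1+n<j)))) (zeroˡ _))) (+-identityʳ _)))

  E-vanish : ∀ t j {k n} → k < n → E t j k n ≈ 0#
  E-vanish t j {k} {n} k<n = Counting.Laws.count-vanish (northEast* k) k S (eastWeightFrom eastW) isCR (λ (u , _) → k < column u)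
    (λ {(u , _)} → ≡.subst (k <_) (≡.sym (column-north u)))
    (λ {s} k<u eq → contradiction (proj₂ (proj₂ (eastFrom-just s eq))) (ℕₚ.<⇒≯ k<u))
    (λ k<u → ℕₚ.<⇒≢ k<u ∘ ≡.sym) C
    (≡.subst (k <_) (≡.sym (column-line t j n)) k<n)

  E-flag : ∀ {k u} → k ≤ N → column u ≤ N → neCount k (u , true) ≈ neCount k (north u , false)
  E-flag k≤N u≤N = trans (E-unfold k≤N u≤N ≡.refl ≡.refl) (+-identityʳ _)

  -- An east step must be followed by a north step, so both terms on the right belong to the next
  -- line: before signs the factor is 1 + X_L. From column `k` on the east step is blocked, but its
  -- term vanishes there anyway.
  E-step : ∀ t j {k n} → k ≤ N → n ≤ N →
           E t j k n ≈ E t (suc j) k n + crossing t j n * E t (suc j) k (suc n)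
  E-step t j {k} {n} k≤N n≤N = cases (ℕₚ.≤-<-connex j n) (ℕₚ.<-≤-connex n k)
    where
    cases : j ≤ n ⊎ n < j → n < k ⊎ k ≤ n →
            E t j k n ≈ E t (suc j) k n + crossing t j n * E t (suc j) k (suc n)
    cases (inj₂ n<j) _ = trans
      (reflexive (≡.cong (λ u → neCount k (u , false)) (line-unmoved {t} n<j)))
      (sym (trans (+-congˡ (trans (*-congʳ (reflexive (crossing-> {t} {j} n<j))) (zeroˡ _))) (+-identityʳ _)))
    cases (inj₁ j≤n) (inj₁ n<k) = trans
      (E-unfold k≤N (column-line-≤ {t} {j} n≤N) (≡.cong (_, false) (north-line j≤n))
        (≡.trans (eastFrom-< (≡.subst (_< k) (≡.sym (column-line t j n)) n<k))
          (≡.cong (λ u → just (u , true)) (east-line j≤n))))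
      (+-congˡ (*-cong (reflexive (≡.sym (crossing-≤ j≤n)))
        (trans (E-flag k≤N (column-line-≤ {t} {j} (ℕₚ.≤-trans n<k k≤N)))
          (reflexive (≡.cong (λ u → neCount k (u , false)) (north-line (ℕₚ.m≤n⇒m≤1+n j≤n)))))))
    cases (inj₁ j≤n) (inj₂ k≤n) = trans
      (E-unfold k≤N (column-line-≤ {t} {j} n≤N) (≡.cong (_, false) (north-line j≤n))
        (eastFrom-≥ (≡.subst (k ≤_) (≡.sym (column-line t j n)) k≤n)))
      (+-congˡ (sym (trans (*-congˡ (E-vanish t (suc j) (s≤s k≤n))) (zeroʳ _))))

  signed : ℕ → ℕ → ℕ → ℕ → Carrier
  signed t j k n = sgn (k ℕ.∸ n) * E t j k n

  signed-vanish : ∀ t j {k n} → k < n → signed t j k n ≈ 0#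
  signed-vanish t j k<n = trans (*-congˡ (E-vanish t j k<n)) (zeroʳ _)

  alternate : ∀ s f y g → s * (f + y * g) + y * (- s * g) ≈ s * f
  alternate s f y g = begin
    s * (f + y * g) + y * (- s * g)        ≈⟨ +-congˡ (trans (sym (*-assoc y (- s) g))
                                                (trans (*-congʳ (*-comm y (- s))) (*-assoc (- s) y g))) ⟩
    s * (f + y * g) + - s * (y * g)        ≈⟨ +-cong (distribˡ s f (y * g)) (sym (-‿distribˡ-* s (y * g))) ⟩
    s * f + s * (y * g) + - (s * (y * g))  ≈⟨ +-assoc _ _ _ ⟩
    s * f + (s * (y * g) + - (s * (y * g))) ≈⟨ +-congˡ (-‿inverseʳ _) ⟩
    s * f + 0#                             ≈⟨ +-identityʳ _ ⟩
    s * f                                  ∎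
    where open RingProperties (CommutativeRing.ring ring) using (-‿distribˡ-*)

  -‿involutive : ∀ s → - (- s) ≈ s
  -‿involutive = RingProperties.-‿involutive (CommutativeRing.ring ring)

  -- The signs turn 1 + X_L into 1 - X_L; the negative term is moved to the left, as `∑-by-parts`
  -- expects.
  signed-step : ∀ t j {k n} → k ≤ N → n ≤ N →
                signed t j k n + crossing t j n * signed t (suc j) k (suc n) ≈ signed t (suc j) k n
  signed-step t j {k} {n} k≤N n≤N with n ℕₚ.<? k
  ... | yes n<k = begin
    sgn (k ℕ.∸ n) * E t j k n + y * (sgn (k ℕ.∸ suc n) * g)
      ≈⟨ +-cong (*-congˡ (E-step t j k≤N n≤N)) (*-congˡ (*-congʳ opposite)) ⟩
    sgn (k ℕ.∸ n) * (E t (suc j) k n + y * g) + y * (- sgn (k ℕ.∸ n) * g)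
      ≈⟨ alternate (sgn (k ℕ.∸ n)) (E t (suc j) k n) y g ⟩
    sgn (k ℕ.∸ n) * E t (suc j) k n ∎
    where
    y = crossing t j n
    g = E t (suc j) k (suc n)
    opposite : sgn (k ℕ.∸ suc n) ≈ - sgn (k ℕ.∸ n)
    opposite = trans (sym (-‿involutive _))
      (-‿cong (reflexive (≡.cong sgn (≡.sym (ℕₚ.+-∸-assoc 1 n<k)))))
  -- Truncated subtraction no longer alternates here: both exponents are 0. The term in column
  -- `suc n` lies beyond `k` and vanishes instead.
  ... | no n≮k = begin
    sgn (k ℕ.∸ n) * E t j k n + y * signed t (suc j) k (suc n)
      ≈⟨ +-cong (*-congˡ (E-step t j k≤N n≤N)) (*-congˡ (signed-vanish t (suc j) k<1+n)) ⟩
    sgn (k ℕ.∸ n) * (E t (suc j) k n + y * E t (suc j) k (suc n)) + y * 0#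
      ≈⟨ +-cong (*-congˡ (trans (+-congˡ (trans (*-congˡ (E-vanish t (suc j) k<1+n)) (zeroʳ _)))
           (+-identityʳ _))) (zeroʳ _) ⟩
    sgn (k ℕ.∸ n) * E t (suc j) k n + 0#
      ≈⟨ +-identityʳ _ ⟩
    sgn (k ℕ.∸ n) * E t (suc j) k n ∎
    where
    y = crossing t j n
    k<1+n = s≤s (ℕₚ.≮⇒≥ n≮k)

  product : ℕ → ℕ → ℕ → ℕ → Carrier
  product t j k m = ∑ (upTo (suc N)) (λ n → signed t j k n * H t j n m)

  -- The factor 1 - X_L of signed e meets (1 - X_L)⁻¹ of h. The offset is `0#` because no east step
  -- enters column 0, and the far boundary term vanishes because column `suc N` lies beyond `k`.
  product-line : ∀ t j {k} m → k ≤ N → product t j k m ≈ product t (suc j) k m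
  product-line t j {k} m k≤N = trans
    (∑-by-parts (suc N) {E⁺ = signed t (suc j) k} {H⁺ = λ n → H t (suc j) n m} {x = crossing t j} 0#
      (λ n n≤N → signed-step t j k≤N (ℕ.s≤s⁻¹ n≤N))
      (λ _ → trans (H-zero t j m) (sym (+-identityʳ _)))
      (λ n n<N → H-suc t j m (ℕ.s≤s⁻¹ n<N))
      (signed-vanish t (suc j) (s≤s k≤N)))
    (trans (+-congʳ (zeroʳ _)) (+-identityˡ _))

  product-lines : ∀ t j {k} m → k ≤ N → product t 0 k m ≈ product t j k m
  product-lines t zero    m k≤N = refl
  product-lines t (suc j) m k≤N = trans (product-lines t j m k≤N) (product-line t j m k≤N)

  product-level : ∀ t {k} m → k ≤ N → product t 0 k m ≈ product (suc t) 0 k m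
  -- Past index `N` every column up to `N` holds its substitute vertex, and these form the first
  -- line of the next level.
  product-level t {k} m k≤N = trans (product-lines t (suc N) m k≤N)
    (∑<-cong (suc N) λ n n<1+N → reflexive (≡.cong₂ (λ u u′ → sgn (k ℕ.∸ n) * neCount k (u , false) * seCount m u′)
      (same n n<1+N) (same n n<1+N)))
    where
    same : ∀ n → n < suc N → line t (suc N) n ≡ line (suc t) 0 n
    same n n<1+N = ≡.trans (line-above {t} n<1+N) (≡.sym (line-toℕ (suc t) {n} zero))

  product-levels : ∀ t {k} m → k ≤ N → product 0 0 k m ≈ product t 0 k m
  product-levels zero    m k≤N = refl
  product-levels (suc t) m k≤N = trans (product-levels t m k≤N) (product-level t m k≤N)

  -- Level `C` is a safe place to stop: its height `C * suc N` is at least `C`.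
  high-enough : ∀ n c → C ≤ height N (line C 0 n) ℕ.+ c
  high-enough n c = ≡.subst (λ u → C ≤ height N u ℕ.+ c) (≡.sym (line-toℕ C {n} zero))
    (ℕₚ.≤-trans (ℕₚ.m≤m*n C (suc N)) (ℕₚ.≤-trans (ℕₚ.m≤m+n _ 0) (ℕₚ.m≤m+n _ c)))

  H-top : ∀ {n} m → n ≤ N → H C 0 n m ≈ δ n m
  H-top {n} m n≤N = trans
    (SE.count-top m C (column-line-≤ {C} {0} n≤N) (high-enough n _))
    (reflexive (≡.cong (λ i → δ i m) (column-line C 0 n)))

  E-top : ∀ {k n} → k ≤ N → n ≤ N → E C 0 k n ≈ δ n k
  E-top {k} {n} k≤N n≤N = trans
    (NE.count-top k k≤N C (column-line-≤ {C} {0} n≤N) (high-enough n _))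
    (reflexive (≡.cong (λ i → δ i k) (column-line C 0 n)))

  product-top : ∀ {k} m → k ≤ N → product C 0 k m ≈ δ k m
  product-top {k} m k≤N = begin
    product C 0 k m
      ≈⟨ ∑<-cong (suc N) (λ n n<1+N → trans
           (*-cong (*-congˡ (E-top k≤N (ℕ.s≤s⁻¹ n<1+N))) (H-top m (ℕ.s≤s⁻¹ n<1+N)))
           (trans (*-assoc _ _ _) (trans (*-congˡ (*-comm _ _)) (sym (*-assoc _ _ _))))) ⟩
    ∑ (upTo (suc N)) (λ n → sgn (k ℕ.∸ n) * δ n m * δ n k)
      ≈⟨ ∑-δʳ (λ n → sgn (k ℕ.∸ n) * δ n m) (s≤s k≤N) ⟩
    sgn (k ℕ.∸ k) * δ k m
      ≡⟨ ≡.cong (λ d → sgn d * δ k m) (ℕₚ.n∸n≡0 k) ⟩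
    1# * δ k m
      ≈⟨ *-identityˡ _ ⟩
    δ k m ∎

  product-δ : ∀ {k} m → k ≤ N → product 0 0 k m ≈ δ k m
  product-δ m k≤N = trans (product-levels C m k≤N) (product-top m k≤N)

-- The sums h and e

module SouthEastPaths (k n : ℕ) where
  open Paths southEast k

  toPath : SEPath k n → Path (v 0 n zero)
  toPath p = record
    { seq     = at
    ; begins  = start
    ; moves   = λ m → Sum.map North⇒north East⇒west (step m)
    ; settles = proj₁ (limit 0) , λ m le → proj₁ (proj₂ (limit 0) m le) }
    where open SEPath p

  fromPath : Path (v 0 n zero) → SEPath k n
  fromPath p = record
    { at    = seq p
    ; start = begins p
    ; step  = λ m → Sum.map north⇒North (λ eq → west⇒East eq) (moves p m)
    ; limit = climbing-limit (proj₁ (settles p)) (proj₂ (settles p)) (north-late p) }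

  sePaths↔ : Inverse (sePaths k n) (pathSetoid (v 0 n zero))
  sePaths↔ = record
    { to = toPath ; from = fromPath ; to-cong = λ eq → eq ; from-cong = λ eq → eq
    ; inverse = (λ eq → eq) , (λ eq → eq) }

module NorthEastPaths (k n : ℕ) where
  open Paths (northEast* n) n

  module _ (p : NE*Path k n) where
    open NE*Path p

    enteredEast : ℕ → Bool
    enteredEast zero    = false
    enteredEast (suc m) = [ const false , const true ] (step m)

    enteredEast-false : ∀ m → East (at m) (at (suc m)) → enteredEast m ≡ false
    enteredEast-false zero    e = ≡.refl
    enteredEast-false (suc m) e with step m
    ... | inj₁ _  = ≡.refl
    ... | inj₂ e′ = contradiction e (noEE m e′)

    column-monotone : ∀ m d → column (at m) ≤ column (at (d ℕ.+ m))
    column-monotone m zero    = ℕₚ.≤-refl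
    column-monotone m (suc d) = ℕₚ.≤-trans (column-monotone m d) (one (step (d ℕ.+ m)))
      where
      one : ∀ {u u′} → North u u′ ⊎ East u u′ → column u ≤ column u′
      one {u} (inj₁ n) = ℕₚ.≤-reflexive (≡.sym (≡.trans (≡.cong column (North⇒north n)) (column-north u)))
      one {u} (inj₂ e) = ℕₚ.≤-trans (ℕₚ.n≤1+n _) (ℕₚ.≤-reflexive (≡.sym (column-East e)))

    -- Columns never decrease and end at `n`. This is what gets the east steps of a path past the
    -- guard of `eastFrom`.
    column-≤ : ∀ m → column (at m) ≤ n
    column-≤ m = ≡.subst (column (at m) ≤_)
      (proj₁ (proj₂ (limit 0) (proj₁ (limit 0) ℕ.+ m) (ℕₚ.m≤m+n _ m))) (column-monotone m (proj₁ (limit 0)))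

    -- The step is a separate argument so that splitting on it also computes the flag of the next
    -- state.
    move : ∀ m (s : North (at m) (at (suc m)) ⊎ East (at m) (at (suc m))) →
           (at (suc m) , [ const false , const true ] s) ≡ (north (at m) , false)
           ⊎ eastFrom n (at m , enteredEast m) ≡ just (at (suc m) , [ const false , const true ] s)
    move m (inj₁ e) = inj₁ (≡.cong (_, false) (North⇒north e))
    move m (inj₂ e) = inj₂ (≡.trans (≡.cong (λ b → eastFrom n (at m , b)) (enteredEast-false m e))
      (≡.trans (eastFrom-< (≡.subst (_≤ n) (column-East e) (column-≤ (suc m))))
        (≡.cong (λ u → just (u , true)) (≡.sym (East⇒east e)))))

    toPath : Path (v 0 k zero , false)
    toPath = record
      { seq     = λ m → at m , enteredEast m
      ; begins  = ≡.cong (_, false) start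
      ; moves   = λ m → move m (step m)
      ; settles = proj₁ (limit 0) , λ m le → proj₁ (proj₂ (limit 0) m le) }

  module _ (p : Path (v 0 k zero , false)) where

    vertex : ℕ → Vertex
    vertex m = proj₁ (seq p m)

    sideStep-East : ∀ m → SideStep p m → East (vertex m) (vertex (suc m))
    sideStep-East m eq = east⇒East (≡.cong proj₁ (proj₁ (proj₂ (eastFrom-just (seq p m) eq))))

    East-sideStep : ∀ m → East (vertex m) (vertex (suc m)) → SideStep p m
    East-sideStep m e with moves p m
    ... | inj₁ eq = contradiction e (North-East-disjoint (≡.cong proj₁ eq))
    ... | inj₂ eq = eq

    fromPath : NE*Path k n
    fromPath = record
      { at    = vertex
      ; start = ≡.cong proj₁ (begins p)
      ; step  = λ m → Sum.map (λ eq → north⇒North (≡.cong proj₁ eq)) (sideStep-East m) (moves p m)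
      -- The first east step sets the flag to `true`, the second could only leave a state with flag
      -- `false`.
      ; noEE  = λ m e e′ → true≢false (≡.trans
          (≡.sym (≡.cong proj₂ (proj₁ (proj₂ (eastFrom-just (seq p m) (East-sideStep m e))))))
          (proj₁ (eastFrom-just (seq p (suc m)) (East-sideStep (suc m) e′))))
      ; limit = climbing-limit (proj₁ (settles p)) (proj₂ (settles p))
          (λ m le → ≡.cong proj₁ (north-late p m le)) }
      where
      true≢false : true ≢ false
      true≢false ()

  -- The flags carry no further information: the first state is given, the columns reveal the kind
  -- of each move, and the kind fixes the next flag.
  vertices-determine : ∀ {s} (p q : Path s) → (∀ m → proj₁ (seq p m) ≡ proj₁ (seq q m)) → p ≗ₚ q
  vertices-determine p q eq zero = ≡.trans (begins p) (≡.sym (begins q))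
  vertices-determine p q eq (suc m) = same (vertices-determine p q eq m) (eq (suc m)) (moves p m) (moves q m)
    where
    open Automaton (northEast* n) using (side; side-column; north-column) renaming (north to north′)
    same : ∀ {s s′ t t′} → s ≡ t → proj₁ s′ ≡ proj₁ t′ →
           s′ ≡ north′ s ⊎ side s ≡ just s′ → t′ ≡ north′ t ⊎ side t ≡ just t′ → s′ ≡ t′
    same ≡.refl _  (inj₁ a) (inj₁ b) = ≡.trans a (≡.sym b)
    same ≡.refl _  (inj₂ a) (inj₂ b) = just-injective (≡.trans (≡.sym a) b)
    same {s} ≡.refl eq (inj₁ a) (inj₂ b) = contradiction
      (≡.trans (≡.cong column (≡.trans (≡.sym eq) (≡.cong proj₁ a))) (north-column s)) (side-column {s} b)
    same {s} ≡.refl eq (inj₂ a) (inj₁ b) = contradiction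
      (≡.trans (≡.cong column (≡.trans eq (≡.cong proj₁ b))) (north-column s)) (side-column {s} a)

  ne*Paths↔ : Inverse (ne*Paths k n) (pathSetoid (v 0 k zero , false))
  ne*Paths↔ = record
    { to = toPath ; from = fromPath
    ; to-cong   = λ {p} {q} → vertices-determine (toPath p) (toPath q)
    ; from-cong = λ eq m → ≡.cong proj₁ (eq m)
    ; inverse   = (λ {q} {p} → vertices-determine (toPath p) q)
                , (λ eq m → ≡.cong proj₁ (eq m)) }

common-bound : ∀ {i p} {I : Set i} {P : I → ℕ → Set p} →
               (∀ {i T T′} → T ≤ T′ → P i T → P i T′) → (∀ i → ∃ (P i)) →
               ∀ is → ∃ λ T → ∀ {i} → i ∈ₗ is → P i T
common-bound upward bound []       = 0 , λ ()
common-bound upward bound (i ∷ is) with bound i | common-bound upward bound is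
... | T , PT | T′ , PT′ = T ⊔ T′ , λ where
  (here ≡.refl) → upward (ℕₚ.m≤m⊔n T T′) PT
  (there i∈)    → upward (ℕₚ.m≤n⊔m T T′) (PT′ i∈)

big-≗ : ∀ {c i} {C : Set c} {I : Set i} (_∙_ : C → C → C) (ε : C) (is : List I) {f g : I → C} →
        (∀ i → f i ≡ g i) → big _∙_ ε is f ≡ big _∙_ ε is g
big-≗ _∙_ ε []       eq = ≡.refl
big-≗ _∙_ ε (i ∷ is) eq = ≡.cong₂ _∙_ (eq i) (big-≗ _∙_ ε is eq)

module LectureHallSums {a ℓ x} (A : CommutativeRing a ℓ) {X : Set x} (_≟_ : DecidableEquality X)
  (isCR : RingLaws (PowerSeries.seriesRing A _≟_) (PowerSeries._≈ₛ_ A _≟_))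
  (w : LectureHall.WeightSystem A _≟_) (summable : LectureHall.IsSummable A _≟_ w) where

  open PowerSeries A _≟_
  open RawRing seriesRing using (_+_; _*_; 0#; 1#)
  open LectureHall A _≟_

  open SeriesProperties A _≟_ isCR
  private
    module A = CommutativeRing A
    module S = IsCommutativeRing isCR

  VanishesFrom : ℕ → Monomial → ℕ → Set _
  VanishesFrom N μ T = ∀ u → T ≤ level u → column u ≤ N → eastWeight w u ∼[ μ ] 0#

  -- Summability bounds the level for one column and one monomial. Finitely many columns and
  -- finitely many left factors of `μ` matter, so a maximum exists.
  vanishesFrom : ∀ N μ → ∃ (VanishesFrom N μ)
  vanishesFrom N μ = proj₁ bound , λ (v t i j) T≤t i≤N → coeffs⇒∼ λ {α} {β} αβ∈ → A.trans
    (proj₂ bound αβ∈ (∈ₚ.∈-upTo⁺ (s≤s i≤N)) j T≤t) (A.sym (coeff-0# α))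
    where
    P : Monomial → ℕ → ℕ → Set _
    P α i T = ∀ {t} j → T ≤ t → coeff (w t i j) α A.≈ A.0#

    column-bound : ∀ α i → ∃ (P α i)
    column-bound α i with summable i α
    ... | is , zero-outside
      with common-bound {P = λ (t , _) T → t < T} (λ le lt → ℕₚ.≤-trans lt le) (λ (t , _) → suc t , ℕₚ.≤-refl) is
    ...   | T , above = T , λ {t} j T≤t → zero-outside (t , j) (λ ∈is → ℕₚ.<⇒≱ (above ∈is) T≤t)

    P-upward : ∀ {α i T T′} → T ≤ T′ → P α i T → P α i T′
    P-upward le p j T′≤t = p j (ℕₚ.≤-trans le T′≤t)

    bound : ∃ λ T → ∀ {αβ} → αβ ∈ₗ factorizations μ → ∀ {i} → i ∈ₗ upTo (suc N) → P (proj₁ αβ) i T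
    bound = common-bound {P = λ αβ T → ∀ {i} → i ∈ₗ upTo (suc N) → P (proj₁ αβ) i T}
      (λ le p i∈ → P-upward le (p i∈))
      (λ (α , _) → common-bound {P = P α} P-upward (column-bound α) (upTo (suc N)))
      (factorizations μ)

  -- The threshold of `level-bound`: a potential of this size forces level `T`.
  steps : ℕ → ℕ → ℕ
  steps N T = suc T ℕ.* suc N

  module SE (k : ℕ) where
    open Paths southEast k public
    open Counting southEast k seriesRing (westWeight (eastWeight w)) public
    open PathSums southEast k (westWeight (eastWeight w)) public

    truncated : ∀ {N μ T C n} → n ≤ N → VanishesFrom N μ T → steps N T ≤ C → Truncated μ (v 0 n zero) C
    truncated {N} {μ} {T} {C} n≤N vanishes large = record
      { stable = Swept.SE.count-stable k n≤N
      ; late   = λ p → Swept.SE.pathWeight-late k p n≤N }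
      where module Swept = Sweep seriesRing (∼-isCommutativeRing μ) (eastWeight w) {N} {T} {C} vanishes large

  module NE (k : ℕ) where
    open Paths (northEast* k) k public
    open Counting (northEast* k) k seriesRing (eastWeightFrom (eastWeight w)) public
    open PathSums (northEast* k) k (eastWeightFrom (eastWeight w)) public

    truncated : ∀ {N μ T C n} → k ≤ N → n ≤ N → VanishesFrom N μ T → steps N T ≤ C →
                Truncated μ (v 0 n zero , false) C
    truncated {N} {μ} {T} {C} k≤N n≤N vanishes large = record
      { stable = Swept.NE.count-stable k k≤N n≤N
      ; late   = λ p → Swept.NE.pathWeight-late k k≤N p n≤N }
      where module Swept = Sweep seriesRing (∼-isCommutativeRing μ) (eastWeight w) {N} {T} {C} vanishes large

  seTruncated : ∀ n k μ → ∃ (SE.Truncated k μ (v 0 n zero))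
  seTruncated n k μ with vanishesFrom n μ
  ... | T , vanishes = steps n T , SE.truncated k ℕₚ.≤-refl vanishes ℕₚ.≤-refl

  -- The column bound has to cover both the initial column `k` and the final column `n`, in either
  -- order.
  neTruncated : ∀ n k μ → ∃ (NE.Truncated n μ (v 0 k zero , false))
  neTruncated n k μ with vanishesFrom (n ⊔ k) μ
  ... | T , vanishes = steps (n ⊔ k) T , NE.truncated n (ℕₚ.m≤m⊔n n k) (ℕₚ.m≤n⊔m n k) vanishes ℕₚ.≤-refl

  h : ℕ → ℕ → Series
  h n k = SE.Total.total k (v 0 n zero) (seTruncated n k)

  e : ℕ → ℕ → Series
  e n k = NE.Total.total n (v 0 k zero , false) (neTruncated n k)

  sePathWeight : ∀ {k n} (p : SEPath k n) → SE.pathWeight k (SouthEastPaths.toPath k n p) ≡ seWeight w p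
  sePathWeight p = big-≗ _*_ 1# (upTo (proj₁ (limit 0))) (λ m → same (at m) (step m))
    where
    open SEPath p
    same : ∀ u {u′} (s : South u′ u ⊎ East u′ u) →
           [ const 1# , const (eastWeight w u′) ] (Sum.map (North⇒north {u}) (East⇒west {u′} {u}) s)
           ≡ [ const 1# , const (eastWeight w u′) ] s
    same u (inj₁ _) = ≡.refl
    same u (inj₂ _) = ≡.refl

  nePathWeight : ∀ {k n} (p : NE*Path k n) → NE.pathWeight n (NorthEastPaths.toPath k n p) ≡ ne*Weight w p
  nePathWeight {k} {n} p = big-≗ _*_ 1# (upTo (proj₁ (limit 0))) (λ m → same m (step m))
    where
    open NE*Path p
    same : ∀ m (s : North (at m) (at (suc m)) ⊎ East (at m) (at (suc m))) →
           [ const 1# , const (eastWeight w (at m)) ] (NorthEastPaths.move k n p m s)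
           ≡ [ const 1# , const (eastWeight w (at m)) ] s
    same m (inj₁ _) = ≡.refl
    same m (inj₂ _) = ≡.refl

  module _ (n k : ℕ) where
    private
      module SEPaths = SouthEastPaths k n
      module NEPaths = NorthEastPaths k n

    se-to : ∀ p → SE.pathWeight k (SEPaths.toPath p) ≈ₛ seWeight w p
    se-to p = S.reflexive (sePathWeight p)

    -- Converting back and forth enlarges the settling bound, since `climbing-limit` waits for the
    -- levels too; the weights are thus compared through equality of paths.
    se-from : ∀ p → seWeight w (SEPaths.fromPath p) ≈ₛ SE.pathWeight k p
    se-from p μ = A.trans (A.sym (se-to (SEPaths.fromPath p) μ))
      (Counting.Laws.pathWeight-cong southEast k seriesRing (westWeight (eastWeight w)) {_≋_ = _≈ₛ_} isCR
        {p = SEPaths.toPath (SEPaths.fromPath p)} {p} (λ _ → ≡.refl) μ)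

    ne-to : ∀ p → NE.pathWeight n (NEPaths.toPath p) ≈ₛ ne*Weight w p
    ne-to p = S.reflexive (nePathWeight p)

    ne-from : ∀ p → ne*Weight w (NEPaths.fromPath p) ≈ₛ NE.pathWeight n p
    ne-from p μ = A.trans (A.sym (ne-to (NEPaths.fromPath p) μ))
      (Counting.Laws.pathWeight-cong (northEast* n) n seriesRing (eastWeightFrom (eastWeight w)) {_≋_ = _≈ₛ_} isCR
        {p = NEPaths.toPath (NEPaths.fromPath p)} {p}
        (NEPaths.vertices-determine (NEPaths.toPath (NEPaths.fromPath p)) p (λ _ → ≡.refl)) μ)

    pathSum-h : HasSum (SE.pathSetoid k (v 0 n zero)) (SE.pathWeight k) (h n k)
    pathSum-h = SE.Total.total-HasSum k (v 0 n zero) (seTruncated n k)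

    pathSum-e : HasSum (NE.pathSetoid n (v 0 k zero , false)) (NE.pathWeight n) (e n k)
    pathSum-e = NE.Total.total-HasSum n (v 0 k zero , false) (neTruncated n k)

    h-IsH : IsH w n k (h n k)
    h-IsH = HasSum-transport (↔-sym SEPaths.sePaths↔) {SE.pathWeight k} {seWeight w} {h n k}
      se-from se-to pathSum-h

    e-IsE : IsE w n k (e n k)
    e-IsE = HasSum-transport (↔-sym NEPaths.ne*Paths↔) {NE.pathWeight n} {ne*Weight w} {e n k}
      ne-from ne-to pathSum-e

    IsH-unique : ∀ {s} → IsH w n k s → s ≈ₛ h n k
    IsH-unique {s} isH = SE.pathSum-unique k {f = s} {h n k}
      (HasSum-transport SEPaths.sePaths↔ {seWeight w} {SE.pathWeight k} {s} se-to se-from isH) pathSum-h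

    IsE-unique : ∀ {s} → IsE w n k s → s ≈ₛ e n k
    IsE-unique {s} isE = NE.pathSum-unique n {f = s} {e n k}
      (HasSum-transport NEPaths.ne*Paths↔ {ne*Weight w} {NE.pathWeight n} {s} ne-to ne-from isE) pathSum-e

  h-vanish : ∀ {n k} → n < k → h n k ≈ₛ 0#
  h-vanish {n} {k} n<k μ = Counting.Laws.count-vanish southEast k seriesRing (westWeight (eastWeight w))
    {_≋_ = _≈ₛ_} isCR (λ u → column u < k)
    (λ {u} → ≡.subst (_< k) (≡.sym (column-north u)))
    (λ {u} u<k eq → ℕₚ.<-trans (ℕₚ.≤-reflexive (≡.sym (column-East (west⇒East {u′ = u} eq)))) u<k)
    ℕₚ.<⇒≢ (proj₁ (seTruncated n k μ)) {v 0 n zero} n<k μ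

  e-vanish : ∀ {n k} → n < k → e n k ≈ₛ 0#
  e-vanish {n} {k} n<k μ = Counting.Laws.count-vanish (northEast* n) n seriesRing (eastWeightFrom (eastWeight w))
    {_≋_ = _≈ₛ_} isCR (λ (u , _) → n < column u)
    (λ {(u , _)} → ≡.subst (n <_) (≡.sym (column-north u)))
    (λ {s} n<u eq → contradiction (proj₂ (proj₂ (eastFrom-just s eq))) (ℕₚ.<⇒≯ n<u))
    (λ n<u → ℕₚ.<⇒≢ n<u ∘ ≡.sym) (proj₁ (neTruncated n k μ)) {v 0 k zero , false} n<k μ

  seriesCommutativeRing : CommutativeRing _ _
  seriesCommutativeRing = record { isCommutativeRing = isCR }

  open FiniteSums seriesCommutativeRing using () renaming (δ to δₛ; mulTo to mulToₛ)

  signed-e : ℕ → ℕ → Series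
  signed-e k n = alternating seriesRing (k ℕ.∸ n) * e k n

  module AtMonomial (N : ℕ) (μ : Monomial) where

    -- The sweep modulo `μ` needs the bound at `μ`, while replacing `e` and `h` by counts needs it
    -- at every left factor; one `T` gives a common cutoff.
    bound : ∃ λ T → ∀ {α} → α ∈ₗ μ ∷ map proj₁ (factorizations μ) → VanishesFrom N α T
    bound = common-bound {P = VanishesFrom N} (λ le vanishes u T≤t → vanishes u (ℕₚ.≤-trans le T≤t))
      (vanishesFrom N) (μ ∷ map proj₁ (factorizations μ))

    T C : ℕ
    T = proj₁ bound
    C = steps N T

    module Swept = Sweep seriesRing (∼-isCommutativeRing μ) (eastWeight w) {N} {T} {C}
      (proj₂ bound (here ≡.refl)) ℕₚ.≤-refl
    open CommutativeRing Swept.ring using (trans; *-cong; *-congˡ; reflexive)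
    open FiniteSums Swept.ring using (∑<-cong)

    e-∼ : ∀ {k n} → k ≤ N → n ≤ N → e k n ∼[ μ ] Swept.E 0 0 k n
    e-∼ {k} {n} k≤N n≤N = trans
      (NE.Total.total-∼ k (v 0 n zero , false) (neTruncated k n)
        (λ αβ∈ → NE.truncated k k≤N n≤N (proj₂ bound (there (∈ₚ.∈-map⁺ proj₁ αβ∈))) ℕₚ.≤-refl) ℕₚ.≤-refl)
      (reflexive (≡.cong (λ u → Swept.neCount k (u , false)) (≡.sym (line-toℕ 0 {n} zero))))

    h-∼ : ∀ {n} m → n ≤ N → h n m ∼[ μ ] Swept.H 0 0 n m
    h-∼ {n} m n≤N = trans
      (SE.Total.total-∼ m (v 0 n zero) (seTruncated n m)
        (λ αβ∈ → SE.truncated m n≤N (proj₂ bound (there (∈ₚ.∈-map⁺ proj₁ αβ∈))) ℕₚ.≤-refl) ℕₚ.≤-refl)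
      (reflexive (≡.cong (Swept.seCount m) (≡.sym (line-toℕ 0 {n} zero))))

    signed-e*h-∼ : ∀ {k} m → k ≤ N → mulToₛ (suc N) signed-e h k m ∼[ μ ] δₛ k m
    signed-e*h-∼ {k} m k≤N = trans
      (∑<-cong (suc N) λ n n<1+N →
        *-cong (*-congˡ (e-∼ k≤N (ℕ.s≤s⁻¹ n<1+N))) (h-∼ m (ℕ.s≤s⁻¹ n<1+N)))
      (Swept.product-δ m k≤N)

  -- Each coefficient is read off from its own congruence. The cutoff varies with `μ`, whereas `e`
  -- and `h` are the same series throughout.
  signed-e*h : ∀ N k m → k < suc N → mulToₛ (suc N) signed-e h k m ≈ₛ δₛ k m
  signed-e*h N k m k<1+N μ = ∼⇒coeff (AtMonomial.signed-e*h-∼ N μ m (ℕ.s≤s⁻¹ k<1+N))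

-- Passage to the field

module EmbeddedSums {a ℓ x c ℓ₁ ℓ₂} (A : CommutativeRing a ℓ) {X : Set x} (_≟_ : DecidableEquality X)
  (K : HeytingField c ℓ₁ ℓ₂) (ι : PowerSeries.Series A _≟_ → HeytingField.Carrier K)
  (emb : Setting.IsEmbedding A _≟_ K ι)
  (w : LectureHall.WeightSystem A _≟_) (summable : LectureHall.IsSummable A _≟_ w) where

  open HeytingField K
  open Setting A _≟_ K

  private
    module S = RawRing seriesRing
    module ι = RingMorphisms.IsRingMonomorphism emb

  open PolynomialSequences K using (fieldRing)
  open FiniteSums fieldRing
  open RawSemiringDefinitions (RawRing.rawSemiring (CommutativeRing.rawRing fieldRing)) using (_^_)
  open import Relation.Binary.Reasoning.Setoid setoid

  -- The laws of convolution are pulled back from the field along the injective `ι`.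
  series-isCommutativeRing : RingLaws seriesRing S._≈_
  series-isCommutativeRing = RingMonomorphism.isCommutativeRing emb isCommutativeRing

  open LectureHallSums A _≟_ series-isCommutativeRing w summable

  ι-∑ : ∀ {i} {I : Set i} (is : List I) (f : I → Series) → ι (big S._+_ S.0# is f) ≈ ∑ is (ι ∘ f)
  ι-∑ []       f = ι.0#-homo
  ι-∑ (i ∷ is) f = trans (ι.+-homo (f i) _) (+-congˡ (ι-∑ is f))

  ι-if : ∀ b → ι (if b then S.1# else S.0#) ≈ (if b then 1# else 0#)
  ι-if true  = ι.1#-homo
  ι-if false = ι.0#-homo

  ι-alternating : ∀ d → ι (alternating seriesRing d) ≈ (- 1#) ^ d
  ι-alternating zero    = ι.1#-homo
  ι-alternating (suc d) = begin
    ι (S.- alternating seriesRing d)  ≈⟨ ι.-‿homo _ ⟩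
    - ι (alternating seriesRing d)    ≈⟨ -‿cong (ι-alternating d) ⟩
    - (- 1#) ^ d                      ≈⟨ -1*x≈-x _ ⟨
    - 1# * (- 1#) ^ d                 ∎
    where open RingProperties (CommutativeRing.ring fieldRing) using (-1*x≈-x)

  ιh ιe : ℕ → ℕ → Carrier
  ιh n k = ι (h n k)
  ιe n k = (- 1#) ^ (n ∸ k) * ι (e n k)

  ιe*ιh : ∀ N k m → k < suc N → mulTo (suc N) ιe ιh k m ≈ δ k m
  ιe*ιh N k m k<1+N = begin
    ∑ (upTo (suc N)) (λ n → (- 1#) ^ (k ∸ n) * ι (e k n) * ι (h n m))
      ≈⟨ ∑-cong (upTo (suc N)) (λ n → *-congʳ (*-congʳ (ι-alternating (k ∸ n)))) ⟨
    ∑ (upTo (suc N)) (λ n → ι (alternating seriesRing (k ∸ n)) * ι (e k n) * ι (h n m))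
      ≈⟨ ∑-cong (upTo (suc N)) (λ n → trans (ι.*-homo _ (h n m)) (*-congʳ (ι.*-homo _ (e k n)))) ⟨
    ∑ (upTo (suc N)) (λ n → ι (signed-e k n S.* h n m))
      ≈⟨ ι-∑ (upTo (suc N)) _ ⟨
    ι (big S._+_ S.0# (upTo (suc N)) (λ n → signed-e k n S.* h n m))
      ≈⟨ ι.⟦⟧-cong (signed-e*h N k m k<1+N) ⟩
    ι (if k ≡ᵇ m then S.1# else S.0#)
      ≈⟨ ι-if (k ≡ᵇ m) ⟩
    δ k m ∎

  module _ {σ : ℕ → ℕ → Carrier} (σ-h : MomentsAreH ι σ w) where

    lower-h : ∀ n k → lower σ n k ≈ ιh n k
    lower-h n k = cases (ℕₚ.≤-<-connex k n)
      where
      cases : k ≤ n ⊎ n < k → lower σ n k ≈ ιh n k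
      cases (inj₁ k≤n) = let h′ , isH , σ≈ = σ-h n k k≤n in
        trans (reflexive (lower-≤ σ k≤n)) (trans σ≈ (ι.⟦⟧-cong {h′} {h n k} (IsH-unique n k {h′} isH)))
      cases (inj₂ n<k) = trans (reflexive (lower-> σ n<k))
        (sym (trans (ι.⟦⟧-cong {h n k} {S.0#} (h-vanish n<k)) ι.0#-homo))

  module _ {ν : ℕ → ℕ → Carrier} (ν-e : CoefficientsAreE ι ν w) where

    lower-e : ∀ n k → lower ν n k ≈ ιe n k
    lower-e n k = cases (ℕₚ.≤-<-connex k n)
      where
      cases : k ≤ n ⊎ n < k → lower ν n k ≈ ιe n k
      cases (inj₁ k≤n) = let e′ , isE , ν≈ = ν-e n k k≤n in
        trans (reflexive (lower-≤ ν k≤n)) (trans ν≈ (*-congˡ (ι.⟦⟧-cong {e′} {e n k} (IsE-unique n k {e′} isE))))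
      cases (inj₂ n<k) = trans (reflexive (lower-> ν n<k))
        (sym (trans (*-congˡ (trans (ι.⟦⟧-cong {e n k} {S.0#} (e-vanish n<k)) ι.0#-homo)) (zeroʳ _)))

  module _ (σ ν : ℕ → ℕ → Carrier)
    (σ*ν : ∀ N i j → i < N → j < N → mulTo N (lower σ) (lower ν) i j ≈ δ i j) where

    -- With `lower σ` identified as `ιh`, it has the left inverse `ιe` and the right inverse
    -- `lower ν`.
    coefficientsAreE : MomentsAreH ι σ w → CoefficientsAreE ι ν w
    coefficientsAreE σ-h n k k≤n = e n k , e-IsE n k , (begin
      ν n k         ≡⟨ lower-≤ ν k≤n ⟨
      lower ν n k   ≈⟨ leftInverse≈rightInverse (suc n) {ιe} {lower σ} {lower ν}
                         (λ i j i<N _ → trans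
                           (∑-cong (upTo (suc n)) (λ l → *-congˡ (lower-h σ-h l j))) (ιe*ιh n i j i<N))
                         (σ*ν (suc n)) n k ℕₚ.≤-refl (s≤s k≤n) ⟨
      ιe n k        ∎)

    -- With `lower ν` identified as `ιe`, it has the left inverse `lower σ` and the right inverse
    -- `ιh`.
    momentsAreH : CoefficientsAreE ι ν w → MomentsAreH ι σ w
    momentsAreH ν-e n k k≤n = h n k , h-IsH n k , (begin
      σ n k         ≡⟨ lower-≤ σ k≤n ⟨
      lower σ n k   ≈⟨ leftInverse≈rightInverse (suc n) {lower σ} {lower ν} {ιh} (σ*ν (suc n))
                         (λ i j i<N _ → trans
                           (∑-cong (upTo (suc n)) (λ l → *-congʳ (lower-e ν-e i l))) (ιe*ιh n i j i<N))
                         n k ℕₚ.≤-refl (s≤s k≤n) ⟩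
      ιh n k        ∎)

proposition2p8 : ∀ {a ℓ x c ℓ₁ ℓ₂ : Level} (A : CommutativeRing a ℓ)
    {X : Set x} (_≟_ : DecidableEquality X)
    (K : HeytingField c ℓ₁ ℓ₂) →
    let open HeytingField K using (Carrier)
        open Setting A _≟_ K
    in
    (ι : Series → Carrier) → IsEmbedding ι →
    (p q : ℕ → Polynomial) →
    (∀ n → HasDegree (p n) n) → (∀ n → HasDegree (q n) n) →
    (σ ν : ℕ → ℕ → Carrier) →
    AreMixedMoments p q σ → AreMixedCoefficients p q ν →
    (w : WeightSystem) → IsSummable w →
    (MomentsAreH ι σ w → CoefficientsAreE ι ν w)
    × (CoefficientsAreE ι ν w → MomentsAreH ι σ w)
proposition2p8 A _≟_ K ι emb p q deg-p deg-q σ ν q≈ p≈ w summable =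
  coefficientsAreE σ ν σ*ν , momentsAreH σ ν σ*ν
  where
  open EmbeddedSums A _≟_ K ι emb w summable
  σ*ν = PolynomialSequences.moments*coefficients K p q σ ν deg-q q≈ p≈
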